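{- Let $G$ and $H$ be Polish groups, let $X$ be a Polish $G$-space and let $Y$ be a Polish $H$-space. Let $n\in\{0,1,2,\ldots\}\cup\{\infty\}$. (1) If $X$ is generically $n$-dimensional and the dimension of $Y$ is less than $n$, then $E^G_X$ does not $*$-reduce to $E^H_Y$. (2) If the dimension of $X$ is less than $n$ and $Y$ is locally generically $n$-dimensional, then $E^G_X$ does not $*$-reduce to $E^H_Y$.
   Context: Polish spaces are taken to be non-empty. A Polish $G$-space is a Polish space $X$ with a continuous action of the Polish group $G$; $E^G_X$ is its orbit equivalence relation and $[x]$ the orbit of $x$. A map $f\colon X\to Y$ between Polish spaces is Baire measurable if preimages of open sets have the Baire property, and category preserving if preimages of meager sets are meager. $E$ on $X$ $*$-reduces to $F$ on $Y$ if there is a Baire measurable category preserving map $f\colon X\to Y$ such that $x\,E\,x'\iff f(x)\,F\,f(x')$ for all $x,x'\in X$. A sequence $(g_n)$ in $G$ is right-Cauchy if it is Cauchy for some (equivalently, any) compatible right-invariant metric. In a Polish $G$-space $X$, $x$ right-embeds in $x'$ if there is a right-Cauchy sequence $(g_n)$ in $G$ with $g_nx'\to x$. For $G$-invariant $C\subseteq X$, $\mathcal{B}(C/G)$ is the digraph whose vertices are the orbits $[x]$, $x\in C$, with an arrow $[x]\to[x']$ iff $x$ right-embeds in $x'$. The combinatorial $m$-cube ($m\ge 0$) is the digraph on the powerset of $\{0,\dots,m-1\}$ with an arrow $\sigma\to\tau$ iff $\sigma\subseteq\tau$. A digraph embedding is an injection that preserves and reflects arrows. For a non-empty $G$-invariant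 $C\subseteq X$, the dimension of $C$ is the largest $m\geq0$ such that the combinatorial $m$-cube embeds in $\mathcal{B}(C/G)$ if such a largest $m$ exists, and $\infty$ otherwise. $X$ is generically $n$-dimensional if $n$ is the largest element of $\{0,1,\dots\}\cup\{\infty\}$ such that every invariant comeager subset of $X$ has dimension at least $n$. $X$ is locally generically $n$-dimensional if $n$ is the largest element of $\{0,1,\dots\}\cup\{\infty\}$ such that every invariant non-meager subset of $X$ with the Baire property has dimension at least $n$. -}

module Defs where

open import Level using (0ℓ) renaming (suc to lsuc)
open import Algebra.Structures using (IsGroup)
open import Data.Fin.Subset using (Subset) renaming (_⊆_ to _⊆ᶠ_)
open import Data.Nat.Base as ℕ using (ℕ)
open import Data.Product using (Σ; ∃; ∃₂; _×_; _,_; proj₁; proj₂; uncurry)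
open import Data.Rational.Base as ℚ using (ℚ; 0ℚ; 1ℚ; _<_)
import Data.Rational.Properties as ℚ
open import Function.Base using (_∘_; _on_)
open import Function.Bundles using (_⇔_; mk⇔; Equivalence)
open import Function.Metric.Structures using (IsGeneralMetric)
open import Relation.Binary.Core using (Rel)
open import Relation.Binary.Definitions using (_Respects₂_)
open import Relation.Binary.Morphism.Structures using (IsOrderMonomorphism)
open import Relation.Binary.PropositionalEquality
  using (_≡_; refl; sym; trans; cong; cong₂; subst; subst₂; isEquivalence)
open import Relation.Binary.Structures using (IsEquivalence)
import Relation.Binary.Construct.On as On
open import Relation.Nullary.Construct.Add.Supremum using (_⁺; [_]; ⊤⁺)
import Relation.Binary.Construct.Add.Supremum.NonStrict as NonStrict
import Relation.Binary.Construct.Add.Supremum.Strict as Strict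
open import Relation.Nullary.Negation using (¬_)
open import Relation.Unary
  using (Pred; _∈_; _⊆_; _≐_; _≬_; _⊢_; _⟨×⟩_; ∁; _∪_; _∖_; ⋃; Empty; Satisfiable; U)

-- A non-negative real r is its open upper Dedekind cut {q ∈ ℚ | r < q};
-- under excluded middle the upper cut determines the lower one.
record ℝ≥0 : Set₁ where
  field
    Above     : Pred ℚ 0ℓ
    inhabited : Satisfiable Above
    positive  : ∀ {q} → q ∈ Above → 0ℚ < q
    upward    : ∀ {p q} → p < q → p ∈ Above → q ∈ Above
    rounded   : ∀ {q} → q ∈ Above → ∃ λ p → p < q × p ∈ Above

open ℝ≥0

infix 4 _<ℚ_ _≃_ _≤_
infixl 6 _+_

_<ℚ_ : ℝ≥0 → ℚ → Set
r <ℚ q = q ∈ Above r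

_≃_ : Rel ℝ≥0 0ℓ
r ≃ s = Above r ≐ Above s

_≤_ : Rel ℝ≥0 0ℓ
r ≤ s = Above s ⊆ Above r

0ℝ : ℝ≥0
0ℝ = record
  { Above     = 0ℚ <_
  ; inhabited = 1ℚ , ℚ.positive⁻¹ 1ℚ
  ; positive  = λ 0<q → 0<q
  ; upward    = λ p<q 0<p → ℚ.<-trans 0<p p<q
  ; rounded   = λ 0<q → let p , 0<p , p<q = ℚ.<-dense 0<q in p , p<q , 0<p
  }

_+_ : ℝ≥0 → ℝ≥0 → ℝ≥0
r + s = record
  { Above     = λ q → ∃₂ λ a b → a ∈ Above r × b ∈ Above s × a ℚ.+ b ℚ.≤ q
  ; inhabited = let a , r<a = inhabited r
                    b , s<b = inhabited s
                in a ℚ.+ b , a , b , r<a , s<b , ℚ.≤-refl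
  ; positive  = λ (a , b , r<a , s<b , a+b≤q) →
                  ℚ.<-≤-trans (ℚ.+-mono-< (positive r r<a) (positive s s<b)) a+b≤q
  ; upward    = λ p<q (a , b , r<a , s<b , a+b≤p) →
                  a , b , r<a , s<b , ℚ.≤-trans a+b≤p (ℚ.<⇒≤ p<q)
  ; rounded   = λ (a , b , r<a , s<b , a+b≤q) →
                  let a′ , a′<a , r<a′ = rounded r r<a
                  in a′ ℚ.+ b , ℚ.<-≤-trans (ℚ.+-monoˡ-< b a′<a) a+b≤q
                   , a′ , b , r<a′ , s<b , ℚ.≤-refl
  }

-- The axioms of a topology are not recorded: below, a family of open sets
-- is either that of a metric or a product of such.
Opens : Set → Set₂
Opens X = Pred (Pred X 0ℓ) (lsuc 0ℓ)

Continuous : ∀ {X Y} → Opens X → Opens Y → (X → Y) → Set₁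
Continuous τ σ f = ∀ {V} → V ∈ σ → (f ⊢ V) ∈ τ

infixr 2 _⊗_
_⊗_ : ∀ {X Y} → Opens X → Opens Y → Opens (X × Y)
(τ ⊗ σ) W = ∀ {p} → p ∈ W →
  ∃₂ λ V V′ → V ∈ τ × V′ ∈ σ × p ∈ (V ⟨×⟩ V′) × (V ⟨×⟩ V′) ⊆ W

module _ {X : Set} where

  Converges : Opens X → (ℕ → X) → X → Set₁
  Converges τ s x =
    ∀ {V} → V ∈ τ → x ∈ V → ∃ λ N → ∀ n → N ℕ.≤ n → s n ∈ V

  IsMetric : (X → X → ℝ≥0) → Set₁
  IsMetric = IsGeneralMetric _≡_ _≃_ _≤_ 0ℝ _+_

  MetricOpen : (X → X → ℝ≥0) → Pred X 0ℓ → Set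
  MetricOpen d V =
    ∀ {x} → x ∈ V → ∃ λ ε → 0ℚ < ε × (∀ y → d x y <ℚ ε → y ∈ V)

  Compatible : Opens X → (X → X → ℝ≥0) → Set₁
  Compatible τ d = IsMetric d × (∀ V → V ∈ τ ⇔ MetricOpen d V)

  Cauchy : (X → X → ℝ≥0) → (ℕ → X) → Set
  Cauchy d s = ∀ ε → 0ℚ < ε →
    ∃ λ N → ∀ m n → N ℕ.≤ m → N ℕ.≤ n → d (s m) (s n) <ℚ ε

  Complete : Opens X → (X → X → ℝ≥0) → Set₁
  Complete τ d = ∀ s → Cauchy d s → ∃ (Converges τ s)

-- A Polish space has at most continuum many points, so taking carriers
-- in the lowest universe is no restriction. The dense sequence also makes
-- the space non-empty.
record PolishSpace : Set₂ where
  field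
    Carrier              : Set
    Open                 : Opens Carrier
    completelyMetrizable : ∃ λ d → Compatible Open d × Complete Open d
    separable            : ∃ λ (s : ℕ → Carrier) →
                             ∀ V → V ∈ Open → Satisfiable V → ∃ λ n → s n ∈ V

module _ (X : PolishSpace) where
  open PolishSpace X

  Closure : Pred Carrier 0ℓ → Pred Carrier (lsuc 0ℓ)
  Closure A x = ∀ V → V ∈ Open → x ∈ V → V ≬ A

  NowhereDense : Pred Carrier 0ℓ → Set₁
  NowhereDense A = ∀ V → V ∈ Open → V ⊆ Closure A → Empty V

  Meager : Pred Carrier 0ℓ → Set₁
  Meager A = ∃ λ (N : ℕ → Pred Carrier 0ℓ) → (∀ n → NowhereDense (N n)) × A ⊆ ⋃ ℕ N

  Comeager : Pred Carrier 0ℓ → Set₁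
  Comeager A = Meager (∁ A)

  BaireProperty : Pred Carrier 0ℓ → Set₁
  BaireProperty A = ∃ λ V → V ∈ Open × Meager ((A ∖ V) ∪ (V ∖ A))

module _ (X Y : PolishSpace) where
  private
    module X = PolishSpace X
    module Y = PolishSpace Y

  BaireMeasurable : (X.Carrier → Y.Carrier) → Set₁
  BaireMeasurable f = ∀ V → V ∈ Y.Open → BaireProperty X (f ⊢ V)

  CategoryPreserving : (X.Carrier → Y.Carrier) → Set₁
  CategoryPreserving f = ∀ A → Meager Y A → Meager X (f ⊢ A)

  *-Reduces : Rel X.Carrier 0ℓ → Rel Y.Carrier 0ℓ → Set₁
  *-Reduces E F = ∃ λ f →
    BaireMeasurable f × CategoryPreserving f × (∀ x x′ → E x x′ ⇔ F (f x) (f x′))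

record PolishGroup : Set₂ where
  infixl 7 _∙_
  infix  8 _⁻¹
  field
    space         : PolishSpace
  open PolishSpace space public
  field
    _∙_           : Carrier → Carrier → Carrier
    ε             : Carrier
    _⁻¹           : Carrier → Carrier
    isGroup       : IsGroup _≡_ _∙_ ε _⁻¹
    ∙-continuous  : Continuous (Open ⊗ Open) Open (uncurry _∙_)
    ⁻¹-continuous : Continuous Open Open _⁻¹

  RightInvariant : (Carrier → Carrier → ℝ≥0) → Set
  RightInvariant d = ∀ g h k → d (g ∙ k) (h ∙ k) ≃ d g h

  RightCauchy : (ℕ → Carrier) → Set₁
  RightCauchy s = ∃ λ d → Compatible Open d × RightInvariant d × Cauchy d s

record PolishGSpace (G : PolishGroup) : Set₂ where
  private module G = PolishGroup G
  infixr 7 _·_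
  field
    space        : PolishSpace
  open PolishSpace space public
  field
    _·_          : G.Carrier → Carrier → Carrier
    ·-identity   : ∀ x → G.ε · x ≡ x
    ·-assoc      : ∀ g h x → (g G.∙ h) · x ≡ g · (h · x)
    ·-continuous : Continuous (G.Open ⊗ Open) Open (uncurry _·_)

  OrbitEq : Rel Carrier 0ℓ
  OrbitEq x x′ = ∃ λ g → g · x ≡ x′

  Invariant : Pred Carrier 0ℓ → Set
  Invariant C = ∀ g {x} → x ∈ C → (g · x) ∈ C

  RightEmbeds : Rel Carrier (lsuc 0ℓ)
  RightEmbeds x x′ = ∃ λ g → G.RightCauchy g × Converges Open (λ n → g n · x′) x

slice-continuous : (X Y Z : PolishSpace) → let open PolishSpace in
  (f : Carrier X → Carrier Y → Carrier Z) →
  Continuous (Open X ⊗ Open Y) (Open Z) (uncurry f) →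
  ∀ x → Continuous (Open Y) (Open Z) (f x)
slice-continuous X Y Z f cts x {V} V-open = from (compatible _) λ {y} fxy∈V →
  let _ , W , _ , W-open , (x∈ , y∈W) , ⊆V = cts V-open {x , y} fxy∈V
      ε , 0<ε , ball⊆W = to (compatible W) W-open y∈W
  in ε , 0<ε , λ y′ d<ε → ⊆V {x , y′} (x∈ , ball⊆W y′ d<ε)
  where
  open Equivalence using (to; from)
  compatible = proj₂ (proj₁ (proj₂ (PolishSpace.completelyMetrizable Y)))

module _ (G : PolishGroup) where
  open PolishGroup G
  open IsGroup isGroup using (assoc; identityˡ; inverseˡ; inverseʳ)
  open Equivalence using (to; from)

  private
    cancelˡ : ∀ h g → h ⁻¹ ∙ (h ∙ g) ≡ g
    cancelˡ h g = trans (sym (assoc (h ⁻¹) h g))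
                 (trans (cong (_∙ g) (inverseˡ h)) (identityˡ g))

    cancelʳ : ∀ h g → h ∙ (h ⁻¹ ∙ g) ≡ g
    cancelʳ h g = trans (sym (assoc h (h ⁻¹) g))
                 (trans (cong (_∙ g) (inverseʳ h)) (identityˡ g))

    translate-continuous : ∀ h → Continuous Open Open (h ∙_)
    translate-continuous = slice-continuous space space space _∙_ ∙-continuous

  RightCauchy-∙ˡ : ∀ h {s} → RightCauchy s → RightCauchy (λ n → h ∙ s n)
  RightCauchy-∙ˡ h {s} (d , (isMetric , compatible) , invariant , cauchy) =
    d′ , (isMetric′ , compatible′) , invariant′ , cauchy′
    where
    open IsGeneralMetric isMetric
      using (isPartialOrder; nonNegative; ≈⇒0; 0⇒≈; triangle)
      renaming (sym to d-sym)
    d′ : Carrier → Carrier → ℝ≥0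
    d′ g k = d (h ⁻¹ ∙ g) (h ⁻¹ ∙ k)
    isMetric′ : IsMetric d′
    isMetric′ = record
      { isSemiMetric = record
        { isQuasiSemiMetric = record
          { isPreMetric = record
            { isProtoMetric = record
              { isPartialOrder  = isPartialOrder
              ; ≈-isEquivalence = isEquivalence
              ; cong            = λ { refl refl → (λ r → r) , (λ r → r) }
              ; nonNegative     = nonNegative
              }
            ; ≈⇒0 = λ { refl → ≈⇒0 refl }
            }
          ; 0⇒≈ = λ {g} {k} d≃0 →
              trans (sym (cancelʳ h g)) (trans (cong (h ∙_) (0⇒≈ d≃0)) (cancelʳ h k))
          }
        ; sym = λ g k → d-sym (h ⁻¹ ∙ g) (h ⁻¹ ∙ k)
        }
      ; triangle = λ g k l → triangle (h ⁻¹ ∙ g) (h ⁻¹ ∙ k) (h ⁻¹ ∙ l)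
      }
    compatible′ : ∀ V → V ∈ Open ⇔ MetricOpen d′ V
    compatible′ V = mk⇔
      (λ V-open {g} g∈V →
        let ε , 0<ε , ball = to (compatible _) (translate-continuous h V-open)
                               {h ⁻¹ ∙ g} (subst V (sym (cancelʳ h g)) g∈V)
        in ε , 0<ε , λ k d<ε → subst V (cancelʳ h k) (ball (h ⁻¹ ∙ k) d<ε))
      (λ V-open′ →
        let hV-open : ((h ∙_) ⊢ V) ∈ Open
            hV-open = from (compatible _) λ {g} hg∈V →
              let ε , 0<ε , ball = V-open′ hg∈V
              in ε , 0<ε , λ k d<ε → ball (h ∙ k)
                   (subst₂ (λ a b → d a b <ℚ ε) (sym (cancelˡ h g)) (sym (cancelˡ h k)) d<ε)
            V-open = to (compatible _) (translate-continuous (h ⁻¹) hV-open)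
        in from (compatible V) λ {g} g∈V →
          let ε , 0<ε , ball = V-open {g} (subst V (sym (cancelʳ h g)) g∈V)
          in ε , 0<ε , λ k d<ε → subst V (cancelʳ h k) (ball k d<ε))
    invariant′ : RightInvariant d′
    invariant′ g l k = subst₂ (λ a b → d a b ≃ d′ g l)
      (assoc (h ⁻¹) g k) (assoc (h ⁻¹) l k) (invariant (h ⁻¹ ∙ g) (h ⁻¹ ∙ l) k)
    cauchy′ : Cauchy d′ (λ n → h ∙ s n)
    cauchy′ ε 0<ε = let N , close = cauchy ε 0<ε in N , λ m n N≤m N≤n →
      subst₂ (λ a b → d a b <ℚ ε)
        (sym (cancelˡ h (s m))) (sym (cancelˡ h (s n))) (close m n N≤m N≤n)

  RightCauchy-∙ʳ : ∀ k {s} → RightCauchy s → RightCauchy (λ n → s n ∙ k)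
  RightCauchy-∙ʳ k {s} (d , compatible , invariant , cauchy) =
    d , compatible , invariant , λ ε 0<ε →
      let N , close = cauchy ε 0<ε
      in N , λ m n N≤m N≤n → proj₂ (invariant (s m) (s n) k) (close m n N≤m N≤n)

  module _ (X : PolishGSpace G) where
    private module X = PolishGSpace X
    open X using (_·_; ·-identity; ·-assoc; OrbitEq; RightEmbeds)

    OrbitEq-isEquivalence : IsEquivalence OrbitEq
    OrbitEq-isEquivalence = record
      { refl  = λ {x} → ε , ·-identity x
      ; sym   = λ { {x} (g , refl) → g ⁻¹ ,
                  trans (sym (·-assoc (g ⁻¹) g x))
                  (trans (cong (_· x) (inverseˡ g)) (·-identity x)) }
      ; trans = λ { {x} (g , refl) (h , refl) → h ∙ g , ·-assoc h g x }
      }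

    RightEmbeds-resp-OrbitEq : RightEmbeds Respects₂ OrbitEq
    RightEmbeds-resp-OrbitEq =
        (λ { {x} x′∼y′ (s , cauchy , s·x′→x) →
           let k , k·y′≡x′ = IsEquivalence.sym OrbitEq-isEquivalence x′∼y′
           in (λ n → s n ∙ k) , RightCauchy-∙ʳ k cauchy , λ {V} V-open x∈V →
                let N , s∈V = s·x′→x V-open x∈V
                in N , λ n N≤n → subst V
                     (trans (cong (s n ·_) (sym k·y′≡x′)) (sym (·-assoc (s n) k _)))
                     (s∈V n N≤n) })
      , (λ { {x′} (h , refl) (s , cauchy , s·x′→x) →
           (λ n → h ∙ s n) , RightCauchy-∙ˡ h cauchy , λ {V} V-open hx∈V →
             let N , s∈ = s·x′→x
                   (slice-continuous space X.space X.space _·_ X.·-continuous h V-open) hx∈V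
             in N , λ n N≤n → subst V (sym (·-assoc h (s n) x′)) (s∈ n N≤n) })

-- Vertices are taken up to _≈_, so that quotient sets can be vertex sets.
record Digraph ℓ : Set (lsuc ℓ) where
  infix 4 _≈_ _⟶_
  field
    Vertex          : Set
    _≈_             : Rel Vertex 0ℓ
    _⟶_             : Rel Vertex ℓ
    ≈-isEquivalence : IsEquivalence _≈_
    ⟶-resp-≈        : _⟶_ Respects₂ _≈_

Embeds : ∀ {a b} → Digraph a → Digraph b → Set _
Embeds A B = ∃ (IsOrderMonomorphism A._≈_ B._≈_ A._⟶_ B._⟶_)
  where
  module A = Digraph A
  module B = Digraph B

Cube : ℕ → Digraph 0ℓ
Cube m = record
  { Vertex          = Subset m
  ; _≈_             = _≡_
  ; _⟶_             = _⊆ᶠ_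
  ; ≈-isEquivalence = isEquivalence
  ; ⟶-resp-≈        = (λ { refl σ⊆τ → σ⊆τ }) , (λ { refl σ⊆τ → σ⊆τ })
  }

-- 𝓑(C/G), an orbit [x] being represented by any of its points.
𝓑 : ∀ {G} (X : PolishGSpace G) → Pred (PolishGSpace.Carrier X) 0ℓ → Digraph (lsuc 0ℓ)
𝓑 {G} X C = record
  { Vertex          = ∃ C
  ; _≈_             = OrbitEq on proj₁
  ; _⟶_             = RightEmbeds on proj₁
  ; ≈-isEquivalence = On.isEquivalence proj₁ (OrbitEq-isEquivalence G X)
  ; ⟶-resp-≈        = On.respects₂ proj₁ RightEmbeds OrbitEq (RightEmbeds-resp-OrbitEq G X)
  }
  where open PolishGSpace X

ℕ∞ : Set
ℕ∞ = ℕ ⁺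

open NonStrict ℕ._≤_ public using () renaming (_≤⁺_ to _≤∞_)
open Strict ℕ._<_ public using () renaming (_<⁺_ to _<∞_)

Largest : ∀ {a r p} {A : Set a} → Rel A r → Pred A p → Pred A _
Largest _≼_ P m = P m × (∀ k → P k → k ≼ m)

module _ {G : PolishGroup} (X : PolishGSpace G) where
  open PolishGSpace X

  LargestCube : Pred Carrier 0ℓ → Pred ℕ (lsuc 0ℓ)
  LargestCube C = Largest ℕ._≤_ (λ m → Embeds (Cube m) (𝓑 X C))

  HasDimension : Pred Carrier 0ℓ → Pred ℕ∞ (lsuc 0ℓ)
  HasDimension C [ m ] = Satisfiable C × LargestCube C m
  HasDimension C ⊤⁺    = Satisfiable C × ¬ ∃ (LargestCube C)

  DimensionAtLeast : Pred Carrier 0ℓ → Pred ℕ∞ (lsuc 0ℓ)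
  DimensionAtLeast C n = ∃ λ k → HasDimension C k × n ≤∞ k

  DimensionLessThan : Pred ℕ∞ (lsuc 0ℓ)
  DimensionLessThan n = ∃ λ k → HasDimension U k × k <∞ n

  GenericallyDimensional : Pred ℕ∞ (lsuc 0ℓ)
  GenericallyDimensional = Largest _≤∞_ λ n →
    ∀ C → Invariant C → Comeager space C → DimensionAtLeast C n

  LocallyGenericallyDimensional : Pred ℕ∞ (lsuc 0ℓ)
  LocallyGenericallyDimensional = Largest _≤∞_ λ n →
    ∀ C → Invariant C → ¬ Meager space C → BaireProperty space C → DimensionAtLeast C n

{-# OPTIONS --safe #-}

-- Let f be a *-reduction. It is continuous on a comeagre G_δ set, so the graphs
-- of f(gx) = h·f(x) (in h) and of y = h·f(x) (in x and h) are relatively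
-- closed. Uniformising them generically, by the argument showing that analytic
-- sets have the Baire property, gives a generically continuous cocycle for f,
-- and a generically continuous section s of f up to orbits, defined on the
-- H-saturated image of f, which has the Baire property.
-- A generically continuous homomorphism of orbit equivalence relations carries
-- right-embeddings of generic points to right-embeddings: along a perturbed
-- right-Cauchy sequence the cocycle converges. Applied to f and to s this yields
-- a comeagre C (as f pulls meagre sets back to meagre sets) on which f preserves
-- and reflects right-embeddability. Hence 𝓑 of the saturation of C embeds in
-- 𝓑(Y/H), and 𝓑 of the saturation of f(C), which is non-meagre with the Baire
-- property after shrinking C to a G_δ set, embeds in 𝓑(X/G).

module Submission where

open import Algebra.Bundles using (Group)
import Algebra.Properties.Group as GroupProperties
open import Algebra.Structures using (IsGroup)
open import Axiom.ExcludedMiddle using (ExcludedMiddle)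
open import Data.Empty using (⊥)
open import Data.Integer.Base as ℤ using (+_)
open import Data.List.Base using (List; []; _∷_; length)
open import Data.List.Properties using (∷-injectiveˡ)
open import Data.Nat.Base as ℕ using (ℕ; zero; suc)
open import Data.Nat.Coprimality using (1-coprimeTo)
open import Data.Nat.Induction using (<-rec)
import Data.Nat.Properties as ℕ
open import Data.Nat.Solver using (module +-*-Solver)
open import Data.Product using (Σ; ∃; ∃₂; _×_; _,_; proj₁; proj₂; uncurry; <_,_>; map₂)
open import Data.Rational.Base as ℚ using (ℚ; 0ℚ)
import Data.Rational.Properties as ℚ
import Data.Rational.Unnormalised.Base as ℚᵘ
import Data.Rational.Unnormalised.Properties as ℚᵘ
open import Data.Sum.Base using (inj₁; inj₂)
open import Data.Unit.Base using (⊤; tt)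
import Data.Vec.Base as Vec
open import Function.Base using (_∘_; id; case_of_; const)
open import Function.Bundles using (_⇔_; mk⇔; Equivalence)
open import Function.Metric.Structures using (IsGeneralMetric)
open import Level using (0ℓ; _⊔_) renaming (suc to lsuc)
open import Relation.Binary.Construct.Add.Supremum.NonStrict ℕ._≤_ using ([_])
open import Relation.Binary.Construct.Add.Supremum.Strict ℕ._<_ using ([_])
open import Relation.Binary.Core using (Rel)
open import Relation.Binary.Definitions using (tri<; tri≈; tri>)
import Relation.Binary.Morphism.Construct.Composition as Compose
open import Relation.Binary.PropositionalEquality
  using (_≡_; refl; sym; trans; cong; cong₂; subst; subst₂; isEquivalence)
open import Relation.Binary.Structures using (IsEquivalence)
open import Relation.Nullary.Construct.Add.Supremum using ([_]; ⊤⁺)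
open import Relation.Nullary.Decidable using (yes; no; True; toWitness; fromWitness; decidable-stable)
open import Relation.Nullary.Negation using (¬_; contradiction)
open import Relation.Unary
  using (Pred; _∈_; _∉_; _⊆_; _∩_; _∪_; _∖_; ∁; _⊢_; ⋃; Satisfiable; U)
open import Defs

-- The obstacle is that `cocycle` is controlled only on a comeagre set of pairs, which may miss
-- every pair (ε , x) and every pair (gₙ , x′) met along a right-Cauchy sequence. So ε never serves
-- as a base point: by Kuratowski-Ulam a generic `a` gives a good pair (a , a⁻¹x), and the elements
-- moving one value of `f` to the next are quotients of two cocycle values over a common point near
-- a⁻¹x. One closedness argument, with limits taken in a complete space, provides both the cocycle
-- and the section. The section is what calls for a G_δ set: its fibres, consisting of pairs in X ×
-- H, need not be closed there, since `f` is continuous only relative to a comeagre set. Internally,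
-- right-Cauchy means that the quotients of the terms tend to ε. The definition asks for a
-- right-invariant compatible metric, hence the Birkhoff-Kakutani construction. The transfer of
-- right-embeddings asks only for a homomorphism of orbit equivalence relations. That `f` reflects
-- orbits enters when the section is shown to be such a homomorphism.

-- Countable index sets.

record Countable (I : Set) : Set where
  field
    enum       : ℕ → I
    index      : I → ℕ
    enum-index : ∀ i → enum (index i) ≡ i

open Countable

ℕ-countable : Countable ℕ
ℕ-countable = record { enum = id ; index = id ; enum-index = λ _ → refl }

unpair : ℕ → ℕ × ℕ
unpair zero    = zero , zero
unpair (suc n) = next (unpair n)
  where
  next : ℕ × ℕ → ℕ × ℕ
  next (a , zero)  = zero , suc a
  next (a , suc b) = suc a , b

-- `unpair` runs through the diagonals one after another. Walking backwards lowers `a` within a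
-- diagonal and then drops to the end of the previous one; `s` numbers the diagonal, so the
-- recursion is lexicographic in `s` and `a`.
unpair-surjective : ∀ s a b → a ℕ.+ b ≡ s → ∃ λ n → unpair n ≡ (a , b)
unpair-surjective s zero zero _ = zero , refl
unpair-surjective (suc s) zero (suc b) b≡s
  with n , eq ← unpair-surjective s b zero (trans (ℕ.+-identityʳ b) (ℕ.suc-injective b≡s))
  = suc n , lemma
  where
  lemma : unpair (suc n) ≡ (zero , suc b)
  lemma rewrite eq = refl
unpair-surjective s (suc a) b a+b≡s
  with n , eq ← unpair-surjective s a (suc b) (trans (ℕ.+-suc a b) a+b≡s)
  = suc n , lemma
  where
  lemma : unpair (suc n) ≡ (suc a , b)
  lemma rewrite eq = refl

×-countable : ∀ {I J} → Countable I → Countable J → Countable (I × J)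
×-countable cI cJ = record
  { enum       = λ n → enum cI (proj₁ (unpair n)) , enum cJ (proj₂ (unpair n))
  ; index      = λ (i , j) → proj₁ (pair i j)
  ; enum-index = λ (i , j) → let eq = proj₂ (pair i j) in cong₂ _,_
      (trans (cong (enum cI ∘ proj₁) eq) (enum-index cI i))
      (trans (cong (enum cJ ∘ proj₂) eq) (enum-index cJ j))
  }
  where pair = λ i j → unpair-surjective _ (index cI i) (index cJ j) refl

List-countable : Countable (List ℕ)
List-countable = record
  { enum       = λ n → decode (proj₁ (unpair n)) (proj₂ (unpair n))
  ; index      = λ ns → proj₁ (pair (length ns) (encode ns))
  ; enum-index = λ ns → trans
      (cong (λ (l , c) → decode l c) (proj₂ (pair (length ns) (encode ns)))) (decode-encode ns)
  }
  where
  pair = λ a b → unpair-surjective _ a b refl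
  decode : ℕ → ℕ → List ℕ
  decode zero    c = []
  decode (suc l) c = proj₁ (unpair c) ∷ decode l (proj₂ (unpair c))
  encode : List ℕ → ℕ
  encode []       = zero
  encode (n ∷ ns) = proj₁ (pair n (encode ns))
  decode-encode : ∀ ns → decode (length ns) (encode ns) ≡ ns
  decode-encode []       = refl
  decode-encode (n ∷ ns) = let eq = proj₂ (pair n (encode ns)) in cong₂ _∷_
    (cong proj₁ eq) (trans (cong (decode (length ns) ∘ proj₂) eq) (decode-encode ns))

-- Spaces with a countable base, and meagre sets in them.

-- Only a base is kept, so that neighbourhoods make sense for predicates of any level. Basic sets
-- are non-empty because otherwise an empty one could witness `Rare` for every set.
record Space : Set₁ where
  field
    Point     : Set
    Index     : Set
    countable : Countable Index
    Basic     : Index → Pred Point 0ℓ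
    nonempty  : ∀ i → Satisfiable (Basic i)
    cover     : ∀ x → ∃ λ i → x ∈ Basic i
    meet      : ∀ {x} i j → x ∈ Basic i → x ∈ Basic j →
                ∃ λ k → x ∈ Basic k × Basic k ⊆ Basic i × Basic k ⊆ Basic j

  Nbhd : ∀ {ℓ} → Point → Pred Point ℓ → Set ℓ
  Nbhd x V = ∃ λ i → x ∈ Basic i × Basic i ⊆ V

  nbhd-basic : ∀ {x} i → x ∈ Basic i → Nbhd x (Basic i)
  nbhd-basic i x∈i = i , x∈i , id

  nbhd-∈ : ∀ {ℓ x} {V : Pred Point ℓ} → Nbhd x V → x ∈ V
  nbhd-∈ (i , x∈i , i⊆V) = i⊆V x∈i

  nbhd-⊆ : ∀ {ℓ ℓ′ x} {V : Pred Point ℓ} {W : Pred Point ℓ′} → V ⊆ W → Nbhd x V → Nbhd x W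
  nbhd-⊆ V⊆W (i , x∈i , i⊆V) = i , x∈i , V⊆W ∘ i⊆V

  nbhd-always : ∀ {ℓ x} {V : Pred Point ℓ} → (∀ y → y ∈ V) → Nbhd x V
  nbhd-always {x = x} all = let i , x∈i = cover x in i , x∈i , λ {y} _ → all y

  nbhd-∩ : ∀ {ℓ ℓ′ x} {V : Pred Point ℓ} {W : Pred Point ℓ′} →
           Nbhd x V → Nbhd x W → Nbhd x (V ∩ W)
  nbhd-∩ (i , x∈i , i⊆V) (j , x∈j , j⊆W) =
    let k , x∈k , k⊆i , k⊆j = meet i j x∈i x∈j
    in k , x∈k , λ y∈k → i⊆V (k⊆i y∈k) , j⊆W (k⊆j y∈k)

  nbhd-interior : ∀ {ℓ x} {V : Pred Point ℓ} → Nbhd x V → Nbhd x (λ y → Nbhd y V)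
  nbhd-interior (i , x∈i , i⊆V) = i , x∈i , λ y∈i → i , y∈i , i⊆V

  nbhd-∀< : ∀ {ℓ x} {V : ℕ → Pred Point ℓ} n → (∀ m → m ℕ.< n → Nbhd x (V m)) →
            Nbhd x (λ y → ∀ m → m ℕ.< n → y ∈ V m)
  nbhd-∀< zero    V∋x = nbhd-always λ _ _ ()
  nbhd-∀< {V = V} (suc n) V∋x = nbhd-⊆
    (λ (y∈Vn , y∈) m m<1+n → case ℕ.m≤n⇒m<n∨m≡n (ℕ.s≤s⁻¹ m<1+n) of λ where
      (inj₁ m<n)  → y∈ m m<n
      (inj₂ refl) → y∈Vn)
    (nbhd-∩ (V∋x n ℕ.≤-refl) (nbhd-∀< n λ m m<n → V∋x m (ℕ.m≤n⇒m≤1+n m<n)))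

  Open′ : ∀ {ℓ} → Pred Point ℓ → Set ℓ
  Open′ V = ∀ {x} → x ∈ V → Nbhd x V

  Rare : ∀ {ℓ} → Pred Point ℓ → Set ℓ
  Rare A = ∀ i → ∃ λ j → Basic j ⊆ Basic i × (∀ {x} → x ∈ Basic j → x ∉ A)

  -- The covering rare sets lie in the lowest universe whatever the level of `A`. Hence conditions
  -- that themselves speak of comeagreness, and so live higher up, can again be called comeagre.
  Meagre : ∀ {ℓ} → Pred Point ℓ → Set (lsuc 0ℓ ⊔ ℓ)
  Meagre A = ∃ λ (N : ℕ → Pred Point 0ℓ) → (∀ n → Rare (N n)) × A ⊆ ⋃ ℕ N

  Comeagre : ∀ {ℓ} → Pred Point ℓ → Set (lsuc 0ℓ ⊔ ℓ)
  Comeagre A = Meagre (∁ A)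

  meagre-⊆ : ∀ {ℓ ℓ′} {A : Pred Point ℓ} {B : Pred Point ℓ′} → A ⊆ B → Meagre B → Meagre A
  meagre-⊆ A⊆B (N , rare , B⊆N) = N , rare , B⊆N ∘ A⊆B

  ⋃-meagre : ∀ {I ℓ} → Countable I → {A : I → Pred Point ℓ} →
             (∀ i → Meagre (A i)) → Meagre (⋃ I A)
  ⋃-meagre cI {A} meagre =
      (λ n → N n (proj₁ (meagre (enum cI (proj₁ (unpair n))))))
    , (λ n → proj₁ (proj₂ (meagre _)) _)
    , λ {x} (i , x∈Ai) →
        let m , x∈N = proj₂ (proj₂ (meagre _)) (subst (λ i → x ∈ A i) (sym (enum-index cI i)) x∈Ai)
            n , eq  = unpair-surjective _ (index cI i) m refl
        in n , subst (λ (a , b) → x ∈ proj₁ (meagre (enum cI a)) b) (sym eq) x∈N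
    where
    N : ℕ → (ℕ → Pred Point 0ℓ) → Pred Point 0ℓ
    N n M = M (proj₂ (unpair n))

  ∪-meagre : ∀ {ℓ ℓ′} {A : Pred Point ℓ} {B : Pred Point ℓ′} →
             Meagre A → Meagre B → Meagre (A ∪ B)
  ∪-meagre (M , M-rare , A⊆M) (N , N-rare , B⊆N) = meagre-⊆
    (λ { (inj₁ x∈A) → 0 , A⊆M x∈A ; (inj₂ x∈B) → 1 , B⊆N x∈B })
    (⋃-meagre ℕ-countable {λ { zero → ⋃ ℕ M ; (suc _) → ⋃ ℕ N }}
      λ { zero → M , M-rare , id ; (suc _) → N , N-rare , id })

  ∅-meagre : ∀ {ℓ} {A : Pred Point ℓ} → (∀ {x} → x ∉ A) → Meagre A
  ∅-meagre empty = (λ _ _ → ⊥) , (λ _ i → i , id , λ _ ()) , λ x∈A → contradiction x∈A empty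


-- Dyadic radii and complete uniform spaces.

p+[q-p] : ∀ p q → p ℚ.+ (q ℚ.- p) ≡ q
p+[q-p] p q = trans (ℚ.+-comm p (q ℚ.- p))
  (trans (ℚ.+-assoc q (ℚ.- p) p) (trans (cong (q ℚ.+_) (ℚ.+-inverseˡ p)) (ℚ.+-identityʳ q)))

unitFraction : ℕ → ℚ
unitFraction n = ℚ.mkℚ (+ 1) n (1-coprimeTo (suc n))

unitFraction-positive : ∀ n → 0ℚ ℚ.< unitFraction n
unitFraction-positive n = ℚ.*<* (ℤ.+<+ (ℕ.s≤s ℕ.z≤n))

unitFraction-antitone : ∀ {m n} → m ℕ.≤ n → unitFraction n ℚ.≤ unitFraction m
unitFraction-antitone m≤n = ℚ.*≤* (ℤ.+≤+ (ℕ.*-monoʳ-≤ 1 (ℕ.s≤s m≤n)))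

unitFraction-archimedean : ∀ q → 0ℚ ℚ.< q → ∃ λ n → unitFraction n ℚ.< q
unitFraction-archimedean (ℚ.mkℚ (ℤ.+ zero) d _) (ℚ.*<* (ℤ.+<+ ()))
unitFraction-archimedean (ℚ.mkℚ ℤ.-[1+ n ] d _) (ℚ.*<* ())
unitFraction-archimedean (ℚ.mkℚ (ℤ.+ suc n) d _) _ =
  suc d , ℚ.*<* (ℤ.+<+ (begin-strict
    1 ℕ.* suc d            ≡⟨ ℕ.*-identityˡ (suc d) ⟩
    suc d                  <⟨ ℕ.n<1+n (suc d) ⟩
    suc (suc d)            ≤⟨ ℕ.m≤n*m (suc (suc d)) (suc n) ⟩
    suc n ℕ.* suc (suc d)  ∎))
  where open ℕ.≤-Reasoning

unitFraction-halves : ∀ m → unitFraction (suc (m ℕ.+ m)) ℚ.+ unitFraction (suc (m ℕ.+ m))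
                            ≡ unitFraction m
unitFraction-halves m = ℚ.toℚᵘ-injective (ℚᵘ.≃-trans
  (ℚ.toℚᵘ-homo-+ (unitFraction (suc (m ℕ.+ m))) (unitFraction (suc (m ℕ.+ m))))
  (ℚᵘ.*≡* (cong (ℤ.+_) (identity m))))
  where
  open +-*-Solver
  identity : ∀ m → (1 ℕ.* suc (suc (m ℕ.+ m)) ℕ.+ 1 ℕ.* suc (suc (m ℕ.+ m))) ℕ.* suc m
                   ≡ 1 ℕ.* (suc (suc (m ℕ.+ m)) ℕ.* suc (suc (m ℕ.+ m)))
  identity = solve 1 (λ m →
    (con 1 :* (con 2 :+ (m :+ m)) :+ con 1 :* (con 2 :+ (m :+ m))) :* (con 1 :+ m)
    := con 1 :* ((con 2 :+ (m :+ m)) :* (con 2 :+ (m :+ m)))) refl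

-- This is 2ᵏ - 1, shifted by one because `unitFraction n` is 1/(n+1).
pred2^ : ℕ → ℕ
pred2^ zero    = zero
pred2^ (suc k) = suc (pred2^ k ℕ.+ pred2^ k)

k≤pred2^ : ∀ k → k ℕ.≤ pred2^ k
k≤pred2^ zero    = ℕ.z≤n
k≤pred2^ (suc k) = ℕ.s≤s (ℕ.≤-trans (k≤pred2^ k) (ℕ.m≤m+n _ _))

abstract
  2^- : ℕ → ℚ
  2^- k = unitFraction (pred2^ k)

  2^-positive : ∀ k → 0ℚ ℚ.< 2^- k
  2^-positive k = unitFraction-positive (pred2^ k)

  2^-halves : ∀ k → 2^- (suc k) ℚ.+ 2^- (suc k) ≡ 2^- k
  2^-halves k = unitFraction-halves (pred2^ k)

  2^-archimedean : ∀ {q} → 0ℚ ℚ.< q → ∃ λ k → 2^- k ℚ.< q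
  2^-archimedean 0<q = let n , n<q = unitFraction-archimedean _ 0<q
                       in n , ℚ.≤-<-trans (unitFraction-antitone (k≤pred2^ n)) n<q

-- Close k x y stands for d x y < 2⁻ᵏ.
record Uniform : Set₁ where
  field
    Point       : Set
    Index       : Set
    countable   : Countable Index
    centre      : Index → Point
    Close       : ℕ → Rel Point 0ℓ
    close-refl  : ∀ {k x} → Close k x x
    close-sym   : ∀ {k x y} → Close k x y → Close k y x
    close-trans : ∀ {k x y z} → Close (suc k) x y → Close (suc k) y z → Close k x z
    close-open  : ∀ {k x y} → Close k x y → ∃ λ m → ∀ {z} → Close m y z → Close k x z
    separated   : ∀ {x y} → (∀ k → Close k x y) → x ≡ y
    dense       : ∀ k x → ∃ λ i → Close k (centre i) x
    complete    : ∀ (s : ℕ → Point) → (∀ k → ∃ λ N → ∀ m n → N ℕ.≤ m → N ℕ.≤ n → Close k (s m) (s n)) →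
                  ∃ λ x → ∀ k → ∃ λ N → ∀ n → N ℕ.≤ n → Close k x (s n)

  close-suc : ∀ {k x y} → Close (suc k) x y → Close k x y
  close-suc xy = close-trans xy close-refl

  close-≤ : ∀ {k l x y} → k ℕ.≤ l → Close l x y → Close k x y
  close-≤ {zero}  {zero}  _   xy = xy
  close-≤ {zero}  {suc l} _   xy = close-≤ {zero} {l} ℕ.z≤n (close-suc xy)
  close-≤ {suc k} {suc l} k≤l xy with ℕ.m≤n⇒m<n∨m≡n k≤l
  ... | inj₁ k<l  = close-≤ (ℕ.s≤s⁻¹ k<l) (close-suc xy)
  ... | inj₂ refl = xy

  abstract
    balls-meet : ∀ {x} ((i , k) (j , l) : Index × ℕ) → Close k (centre i) x → Close l (centre j) x →
      Σ (Index × ℕ) λ (h , p) → Close p (centre h) x × Close p (centre h) ⊆ Close k (centre i)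
                                         × Close p (centre h) ⊆ Close l (centre j)
    balls-meet {x} (i , k) (j , l) ix jx =
      let m , i-ball = close-open ix
          n , j-ball = close-open jx
          p          = m ℕ.⊔ n
          h , hx     = dense (suc p) x
          h-ball : ∀ {y} → Close (suc p) (centre h) y → Close p x y
          h-ball hy  = close-trans (close-sym hx) hy
      in (h , suc p) , hx , (λ hy → i-ball (close-≤ (ℕ.m≤m⊔n m n) (h-ball hy)))
                          , (λ hy → j-ball (close-≤ (ℕ.m≤n⊔m m n) (h-ball hy)))

  topology : Space
  topology = record
    { Point     = Point
    ; Index     = Index × ℕ
    ; countable = ×-countable countable ℕ-countable
    ; Basic     = λ (i , k) → Close k (centre i)
    ; nonempty  = λ (i , k) → centre i , close-refl
    ; cover     = λ x → let i , ix = dense 0 x in (i , 0) , ix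
    ; meet      = balls-meet
    }

  open Space topology public using (Nbhd)

  nbhd⇒ball : ∀ {ℓ x} {V : Pred Point ℓ} → Nbhd x V → ∃ λ k → ∀ {y} → Close k x y → y ∈ V
  nbhd⇒ball ((i , k) , ix , i⊆V) = map₂ (λ ball xy → i⊆V (ball xy)) (close-open ix)

  ball⇒nbhd : ∀ {ℓ x} {V : Pred Point ℓ} k → (∀ {y} → Close k x y → y ∈ V) → Nbhd x V
  ball⇒nbhd {x = x} k ball =
    let i , ix = dense (suc k) x
    in (i , suc k) , ix , λ iy → ball (close-trans (close-sym ix) iy)

  nbhd-ball : ∀ {x} k → Nbhd x (Close k x)
  nbhd-ball k = ball⇒nbhd k id

open Uniform using (topology)

infixr 2 _×ᵤ_
_×ᵤ_ : Uniform → Uniform → Uniform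
S ×ᵤ T = record
  { Point       = S.Point × T.Point
  ; Index       = S.Index × T.Index
  ; countable   = ×-countable S.countable T.countable
  ; centre      = λ (i , j) → S.centre i , T.centre j
  ; Close       = λ k (x , y) (x′ , y′) → S.Close k x x′ × T.Close k y y′
  ; close-refl  = S.close-refl , T.close-refl
  ; close-sym   = λ (p , q) → S.close-sym p , T.close-sym q
  ; close-trans = λ (p , q) (p′ , q′) → S.close-trans p p′ , T.close-trans q q′
  ; close-open  = λ (p , q) → let m , S-ball = S.close-open p
                                  n , T-ball = T.close-open q
                              in m ℕ.⊔ n , λ (p , q) →
                                   S-ball (S.close-≤ (ℕ.m≤m⊔n m n) p)
                                 , T-ball (T.close-≤ (ℕ.m≤n⊔m m n) q)
  ; separated   = λ close → cong₂ _,_ (S.separated (proj₁ ∘ close)) (T.separated (proj₂ ∘ close))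
  ; dense       = λ k (x , y) → let i , ix = S.dense k x
                                    j , jy = T.dense k y
                                in (i , j) , ix , jy
  ; complete    = λ s cauchy →
      let x , s→x = S.complete (proj₁ ∘ s) λ k → let N , close = cauchy k
                    in N , λ m n N≤m N≤n → proj₁ (close m n N≤m N≤n)
          y , s→y = T.complete (proj₂ ∘ s) λ k → let N , close = cauchy k
                    in N , λ m n N≤m N≤n → proj₂ (close m n N≤m N≤n)
      in (x , y) , λ k → let M , x-close = s→x k
                             N , y-close = s→y k
                         in M ℕ.⊔ N , λ n ≤n → x-close n (ℕ.m⊔n≤o⇒m≤o M N ≤n)
                                             , y-close n (ℕ.m⊔n≤o⇒n≤o M N ≤n)
  }
  where
  module S = Uniform S
  module T = Uniform T

-- Polish spaces as complete uniform spaces.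

module Metric (P : PolishSpace) where
  open PolishSpace P

  private
    d          = proj₁ completelyMetrizable
    isMetric   = proj₁ (proj₁ (proj₂ completelyMetrizable))
    compatible = proj₂ (proj₁ (proj₂ completelyMetrizable))
    complete   = proj₂ (proj₂ completelyMetrizable)
    open IsGeneralMetric isMetric using (≈⇒0; 0⇒≈; triangle) renaming (sym to d-sym)
    open Equivalence
    open ℝ≥0

    triangle-< : ∀ {x y z a b c} → d x y <ℚ a → d y z <ℚ b → a ℚ.+ b ℚ.≤ c → d x z <ℚ c
    triangle-< {x} {y} {z} {a} {b} xy yz a+b≤c = triangle x y z (a , b , xy , yz , a+b≤c)

    <-open : ∀ {x y q} → d x y <ℚ q → ∃ λ δ → 0ℚ ℚ.< δ × (∀ z → d y z <ℚ δ → d x z <ℚ q)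
    <-open {x} {y} {q} xy =
      let p , p<q , xy′ = rounded (d x y) xy
      in q ℚ.- p
       , subst (ℚ._< q ℚ.- p) (ℚ.+-inverseʳ p) (ℚ.+-monoˡ-< (ℚ.- p) p<q)
       , λ z yz → triangle-< xy′ yz (ℚ.≤-reflexive (p+[q-p] p q))

    ball-open : ∀ {x q} → (λ y → d x y <ℚ q) ∈ Open
    ball-open = from (compatible _) <-open

    refl-< : ∀ {x q} → 0ℚ ℚ.< q → d x x <ℚ q
    refl-< = proj₂ (≈⇒0 refl)

  private
    Close : ℕ → Rel Carrier 0ℓ
    Close k x y = d x y <ℚ 2^- k

    abstract
      close-refl : ∀ {k x} → Close k x x
      close-refl {k} = refl-< (2^-positive k)

      close-sym : ∀ {k x y} → Close k x y → Close k y x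
      close-sym {k} {x} {y} = proj₁ (d-sym x y)

      close-trans : ∀ {k x y z} → Close (suc k) x y → Close (suc k) y z → Close k x z
      close-trans {k} xy yz = triangle-< xy yz (ℚ.≤-reflexive (2^-halves k))

      close-open : ∀ {k x y} → Close k x y → ∃ λ m → ∀ {z} → Close m y z → Close k x z
      close-open {k} {x} {y} xy =
        let δ , 0<δ , ball = <-open xy
            m , m<δ = 2^-archimedean 0<δ
        in m , λ {z} yz → ball z (upward (d y z) m<δ yz)

      separated : ∀ {x y} → (∀ k → Close k x y) → x ≡ y
      separated {x} {y} close = 0⇒≈ (positive (d x y) , λ 0<q →
        let k , k<q = 2^-archimedean 0<q in upward (d x y) k<q (close k))

      dense : ∀ k x → ∃ λ i → Close k (proj₁ separable i) x
      dense k x =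
        let n , xn = proj₂ separable _ (ball-open {x} {2^- k}) (x , close-refl {k} {x})
        in n , close-sym {k} xn

      close-complete : ∀ (s : ℕ → Carrier) →
        (∀ k → ∃ λ N → ∀ m n → N ℕ.≤ m → N ℕ.≤ n → Close k (s m) (s n)) →
        ∃ λ x → ∀ k → ∃ λ N → ∀ n → N ℕ.≤ n → Close k x (s n)
      close-complete s cauchy =
        let x , s→x = complete s λ ε 0<ε →
              let k , k<ε = 2^-archimedean 0<ε
                  N , close = cauchy k
              in N , λ m n N≤m N≤n → upward (d (s m) (s n)) k<ε (close m n N≤m N≤n)
        in x , λ k → s→x (ball-open {x} {2^- k}) (close-refl {k} {x})

  uniform : Uniform
  uniform = record
    { Point       = Carrier
    ; Index       = ℕ
    ; countable   = ℕ-countable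
    ; centre      = proj₁ separable
    ; Close       = Close
    ; close-refl  = λ {k} → close-refl {k}
    ; close-sym   = λ {k} → close-sym {k}
    ; close-trans = close-trans
    ; close-open  = close-open
    ; separated   = separated
    ; dense       = dense
    ; complete    = close-complete
    }

  open Uniform uniform using (nbhd⇒ball; ball⇒nbhd)
  open Space (topology uniform)

  basic-open : ∀ i → Basic i ∈ Open
  basic-open i = ball-open

  open⇒nbhd : ∀ {V x} → V ∈ Open → x ∈ V → Nbhd x V
  open⇒nbhd V-open x∈V =
    let ε , 0<ε , ball = to (compatible _) V-open x∈V
        k , k<ε = 2^-archimedean 0<ε
    in ball⇒nbhd k λ {y} xy → ball y (upward (d _ _) k<ε xy)

  nbhd⇒open : ∀ {V} → (∀ {x} → x ∈ V → Nbhd x V) → V ∈ Open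
  nbhd⇒open V-open = from (compatible _) λ x∈V →
    let k , ball = nbhd⇒ball (V-open x∈V)
    in 2^- k , 2^-positive _ , λ y xy → ball xy

  rare⇒nowhereDense : ∀ {A} → Rare A → NowhereDense P A
  rare⇒nowhereDense rare V V-open V⊆cl x x∈V =
    let i , x∈i , i⊆V      = open⇒nbhd V-open x∈V
        j , j⊆i , j∩A=∅    = rare i
        y , y∈j            = nonempty j
        z , z∈j , z∈A      = V⊆cl (i⊆V (j⊆i y∈j)) (Basic j) (basic-open j) y∈j
    in j∩A=∅ z∈j z∈A

  meagre⇒meager : ∀ {A} → Meagre A → Meager P A
  meagre⇒meager (N , rare , A⊆N) = N , (λ n → rare⇒nowhereDense (rare n)) , A⊆N

  module _ (em : ∀ {ℓ} → ExcludedMiddle ℓ) where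

    nowhereDense⇒rare : ∀ {A} → NowhereDense P A → Rare A
    nowhereDense⇒rare {A} nowhere i = decidable-stable em λ none →
      let x , x∈i = nonempty i
      in nowhere (Basic i) (basic-open i) (λ {y} → adherent none y) x x∈i
      where
      adherent : ¬ (∃ λ j → Basic j ⊆ Basic i × (∀ {x} → x ∈ Basic j → x ∉ A)) →
                 ∀ y → y ∈ Basic i → y ∈ Closure P A
      adherent none y y∈i V V-open y∈V = decidable-stable em λ V∩A=∅ →
        none (proj₁ inner , (λ z∈j → proj₁ (proj₂ (proj₂ inner) z∈j))
                          , λ z∈j z∈A → V∩A=∅ (_ , proj₂ (proj₂ (proj₂ inner) z∈j) , z∈A))
        where inner = nbhd-∩ (nbhd-basic i y∈i) (open⇒nbhd V-open y∈V)

    meager⇒meagre : ∀ {A} → Meager P A → Meagre A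
    meager⇒meagre (N , nowhere , A⊆N) = N , (λ n → nowhereDense⇒rare (nowhere n)) , A⊆N

-- The Baire category theorem.

module BaireCategory (em : ∀ {ℓ} → ExcludedMiddle ℓ) (T : Uniform) where
  open Uniform T hiding (topology)
  open Space (topology T) using (Basic; Comeagre)

  comeagre-meets-basic : ∀ {ℓ} {A : Pred Point ℓ} i → Comeagre A → ∃ (A ∩ Basic i)
  comeagre-meets-basic {A = A} i₀ (N , rare , ∁A⊆N) = x , decidable-stable em x∉A , x∈i₀
    where
    step : Index × ℕ → ℕ → Index × ℕ
    -- The summand `suc k` halves the radius at least once, so that the limit, which is only
    -- adherent to the new ball, still lies in the ball missing `N n`; `suc n` drives the radii to
    -- 0. The initial ball is halved for the same reason.
    step i n = let (j , k) , _ = rare n i in j , suc n ℕ.+ suc k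
    ball : ℕ → Index × ℕ
    ball zero    = proj₁ i₀ , suc (proj₂ i₀)
    ball (suc n) = step (ball n) n
    inside : ∀ n → Basic (proj₁ (rare n (ball n))) ⊆ Basic (ball n)
    inside n = proj₁ (proj₂ (rare n (ball n)))
    shrink : ∀ n → Basic (ball (suc n)) ⊆ Basic (proj₁ (rare n (ball n)))
    shrink n = close-≤ (ℕ.≤-trans (ℕ.n≤1+n _) (ℕ.m≤n+m _ (suc n)))
    nested′ : ∀ m d → Basic (ball (d ℕ.+ m)) ⊆ Basic (ball m)
    nested′ m zero    = id
    nested′ m (suc d) = nested′ m d ∘ inside (d ℕ.+ m) ∘ shrink (d ℕ.+ m)
    nested : ∀ {m n} → m ℕ.≤ n → Basic (ball n) ⊆ Basic (ball m)
    nested {m} {n} m≤n = subst (λ l → Basic (ball l) ⊆ Basic (ball m)) (ℕ.m∸n+n≡m m≤n)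
                           (nested′ m (n ℕ.∸ m))
    c : ℕ → Point
    c n = centre (proj₁ (ball n))
    near : ∀ {m n} → m ℕ.≤ n → c n ∈ Basic (ball m)
    near m≤n = nested m≤n close-refl
    near-suc : ∀ {k n} → suc (suc k) ℕ.≤ n → Close (suc k) (c (suc (suc k))) (c n)
    near-suc {k} le = close-≤ (ℕ.≤-trans (ℕ.n≤1+n _) (ℕ.m≤m+n _ _)) (near le)
    limit : ∃ λ x → ∀ k → ∃ λ N → ∀ n → N ℕ.≤ n → Close k x (c n)
    limit = complete c λ k → suc (suc k) , λ m n ≤m ≤n →
      close-trans (close-sym (near-suc ≤m)) (near-suc ≤n)
    x : Point
    x = proj₁ limit
    within : ∀ {k} n → suc k ℕ.≤ proj₂ (ball n) → Close k (c n) x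
    within {k} n k<ball = let M , close = proj₂ limit (suc k) in close-trans
      (close-≤ k<ball (near (ℕ.m≤m⊔n n M)))
      (close-sym (close _ (ℕ.m≤n⊔m n M)))
    x∈i₀ : x ∈ Basic i₀
    x∈i₀ = within 0 ℕ.≤-refl
    x∉A : x ∉ ∁ A
    x∉A x∈∁A = let n , x∈N = ∁A⊆N x∈∁A
               in proj₂ (proj₂ (rare n (ball n))) (within (suc n) (ℕ.m≤n+m _ (suc n))) x∈N

  abstract
    comeagre-meets : ∀ {ℓ ℓ′ x} {A : Pred Point ℓ} {V : Pred Point ℓ′} →
                     Comeagre A → Nbhd x V → ∃ (A ∩ V)
    comeagre-meets comeagre (i , _ , i⊆V) =
      let y , y∈A , y∈i = comeagre-meets-basic i comeagre in y , y∈A , i⊆V y∈i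

open Space

-- Products, continuous maps and open maps.

module _ (S T : Space) where

  infixr 2 _×ₛ_
  _×ₛ_ : Space
  _×ₛ_ = record
    { Point     = Point S × Point T
    ; Index     = Index S × Index T
    ; countable = ×-countable (countable S) (countable T)
    ; Basic     = λ (i , j) (x , y) → x ∈ Basic S i × y ∈ Basic T j
    ; nonempty  = λ (i , j) → let x , x∈i = nonempty S i
                                  y , y∈j = nonempty T j
                              in (x , y) , x∈i , y∈j
    ; cover     = λ (x , y) → let i , x∈i = cover S x
                                  j , y∈j = cover T y
                              in (i , j) , x∈i , y∈j
    ; meet      = λ (i , j) (i′ , j′) (x∈i , y∈j) (x∈i′ , y∈j′) →
        let k , x∈k , k⊆i , k⊆i′ = meet S i i′ x∈i x∈i′
            l , y∈l , l⊆j , l⊆j′ = meet T j j′ y∈j y∈j′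
        in (k , l) , (x∈k , y∈l) , (λ (x∈ , y∈) → k⊆i x∈ , l⊆j y∈)
                                 , (λ (x∈ , y∈) → k⊆i′ x∈ , l⊆j′ y∈)
    }

  record ContinuousAt (f : Point S → Point T) (x : Point S) : Set where
    constructor continuous
    field preimage-basic : ∀ {j} → f x ∈ Basic T j → Nbhd S x (f ⊢ Basic T j)

  open ContinuousAt public

  OpenMap : (Point S → Point T) → Set
  OpenMap f = ∀ {i x} → x ∈ Basic S i → Nbhd T (f x) (λ y → ∃ λ x′ → x′ ∈ Basic S i × f x′ ≡ y)

  preimage-nbhd : ∀ {ℓ f x} {V : Pred (Point T) ℓ} →
                  ContinuousAt f x → Nbhd T (f x) V → Nbhd S x (f ⊢ V)
  preimage-nbhd cts (j , fx∈j , j⊆V) = nbhd-⊆ S j⊆V (preimage-basic cts fx∈j)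

  -- Openness puts a basic set inside the image of `Basic S i`. A smaller basic set missing `A` is
  -- therefore hit by a point of `Basic S i`, and continuity pulls it back around that point.
  preimage-rare : ∀ {f} {A : Pred (Point T) 0ℓ} → (∀ x → ContinuousAt f x) → OpenMap f →
                  Rare T A → Rare S (f ⊢ A)
  preimage-rare {f} {A} cts open-f rare i =
    let x , x∈i              = nonempty S i
        j , fx∈j , j⊆f[i]    = open-f x∈i
        k , k⊆j , k∩A=∅      = rare j
        y , y∈k              = nonempty T k
        x′ , x′∈i , fx′≡y    = j⊆f[i] (k⊆j y∈k)
        l , _ , l⊆           = nbhd-∩ S (nbhd-basic S i x′∈i)
                                 (preimage-basic (cts x′) (subst (_∈ Basic T k) (sym fx′≡y) y∈k))
    in l , (λ z∈l → proj₁ (l⊆ z∈l)) , λ z∈l → k∩A=∅ (proj₂ (l⊆ z∈l))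

  preimage-comeagre : ∀ {ℓ f} {A : Pred (Point T) ℓ} → (∀ x → ContinuousAt f x) → OpenMap f →
                      Comeagre T A → Comeagre S (f ⊢ A)
  preimage-comeagre {f = f} cts open-f (N , rare , A⊆N) =
    (λ n → f ⊢ N n) , (λ n → preimage-rare cts open-f (rare n)) , A⊆N

module _ {S T W : Space} where

  ∘-continuousAt : ∀ {f g x} → ContinuousAt T W g (f x) → ContinuousAt S T f x →
                   ContinuousAt S W (g ∘ f) x
  ∘-continuousAt cts-g cts-f =
    continuous λ gfx∈ → preimage-nbhd S T cts-f (preimage-basic cts-g gfx∈)

  <,>-continuousAt : ∀ {f g x} → ContinuousAt S T f x → ContinuousAt S W g x →
                     ContinuousAt S (T ×ₛ W) < f , g > x
  <,>-continuousAt cts-f cts-g = continuous λ (fx∈ , gx∈) →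
    nbhd-∩ S (preimage-basic cts-f fx∈) (preimage-basic cts-g gx∈)

module _ {S T : Space} where

  const-continuousAt : ∀ {y x} → ContinuousAt S T (const y) x
  const-continuousAt = continuous λ y∈ → nbhd-always S λ _ → y∈

  proj₁-continuousAt : ∀ {p} → ContinuousAt (S ×ₛ T) S proj₁ p
  proj₁-continuousAt {x , y} = continuous λ {i} x∈i →
    let j , y∈j = cover T y in (i , j) , (x∈i , y∈j) , proj₁

  proj₂-continuousAt : ∀ {p} → ContinuousAt (S ×ₛ T) T proj₂ p
  proj₂-continuousAt {x , y} = continuous λ {j} y∈j →
    let i , x∈i = cover S x in (i , j) , (x∈i , y∈j) , proj₂

id-continuousAt : ∀ {S x} → ContinuousAt S S id x
id-continuousAt {S} = continuous λ {j} → nbhd-basic S j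

-- Category arguments with excluded middle; Souslin schemes.

module Category (em : ∀ {ℓ} → ExcludedMiddle ℓ) where

  byContradiction : ∀ {p} {P : Set p} → ¬ ¬ P → P
  byContradiction = decidable-stable em

  ¬∀⇒∃¬ : ∀ {a p} {A : Set a} {P : A → Set p} → ¬ (∀ x → P x) → ∃ λ x → ¬ P x
  ¬∀⇒∃¬ ¬all = byContradiction λ none →
    ¬all λ x → byContradiction λ ¬Px → none (x , ¬Px)

  -- Excluded middle brings every proposition down to the lowest universe.
  Small : ∀ {p} → Set p → Set
  Small P = True (em {P = P})

  small : ∀ {p} {P : Set p} → P → Small P
  small = fromWitness

  large : ∀ {p} {P : Set p} → Small P → P
  large = toWitness

  least : ∀ {p} {P : Pred ℕ p} → ∃ P → ∃ λ n → P n × (∀ m → m ℕ.< n → ¬ P m)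
  least {P = P} (n , Pn) = byContradiction λ none →
    <-rec (∁ P) (λ m below Pm → none (m , Pm , λ _ → below)) n Pn

  comeagre-∩ : ∀ S {ℓ ℓ′} {A : Pred (Point S) ℓ} {B : Pred (Point S) ℓ′} →
               Comeagre S A → Comeagre S B → Comeagre S (A ∩ B)
  comeagre-∩ S {A = A} {B} cA cB = meagre-⊆ S
    (λ ¬AB → case em of λ where
      (yes x∈A) → inj₂ λ x∈B → ¬AB (x∈A , x∈B)
      (no x∉A)  → inj₁ x∉A)
    (∪-meagre S cA cB)

  comeagre-⋂ : ∀ S {I : Set} {ℓ} → Countable I → {A : I → Pred (Point S) ℓ} →
               (∀ i → Comeagre S (A i)) → Comeagre S (λ x → ∀ i → x ∈ A i)
  comeagre-⋂ S cI cA = meagre-⊆ S ¬∀⇒∃¬ (⋃-meagre S cI cA)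

  rare⇒meagre : ∀ S {ℓ} {A : Pred (Point S) ℓ} → Rare S A → Meagre S A
  rare⇒meagre S {A = A} rare = (λ _ x → Small (A x))
    , (λ _ i → let j , j⊆i , j∩A=∅ = rare i in j , j⊆i , λ x∈j x∈A → j∩A=∅ x∈j (large x∈A))
    , λ x∈A → 0 , small x∈A

  comeagre⊇Gδ : ∀ S {ℓ} {A : Pred (Point S) ℓ} → Comeagre S A →
    ∃ λ (O : ℕ → Pred (Point S) 0ℓ) → (∀ k → Open′ S (O k)) ×
      Comeagre S (λ x → ∀ k → x ∈ O k) × (∀ {x} → (∀ k → x ∈ O k) → x ∈ A)
  comeagre⊇Gδ S (N , rare , ∁A⊆N) =
      (λ k x → Nbhd S x (∁ (N k)))
    , (λ k → nbhd-interior S)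
    , comeagre-⋂ S ℕ-countable (λ k → rare⇒meagre S λ i →
        let j , j⊆i , j∩N=∅ = rare k i
        in j , j⊆i , λ x∈j x∉O → x∉O (j , x∈j , λ {_} → j∩N=∅))
    , λ x∈O → byContradiction λ x∉A → let k , x∈N = ∁A⊆N x∉A in nbhd-∈ S (x∈O k) x∈N

  -- One half of the Kuratowski-Ulam theorem. `K n i` collects the `y` near which no basic part of
  -- `Basic S i` avoids `N n` uniformly. There are countably many of these sets, each of them rare,
  -- and off their union all sections of all `N n` are rare.
  sections-comeagre : ∀ S T {ℓ} {M : Pred (Point S × Point T) ℓ} → Comeagre (S ×ₛ T) M →
                      Comeagre T (λ y → Comeagre S (λ x → (x , y) ∈ M))
  sections-comeagre S T {M = M} (N , rare , ∁M⊆N) = meagre-⊆ T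
    (λ ¬meagre → byContradiction λ none → ¬meagre
      ( (λ n x → N n (x , _))
      , (λ n i → let j , j⊆i , y∈ = byContradiction λ k → none ((n , i) , k)
                 in j , j⊆i , λ x∈j → nbhd-∈ T y∈ x∈j)
      , ∁M⊆N))
    (⋃-meagre T (×-countable ℕ-countable (countable S)) λ (n , i) → rare⇒meagre T (rare-K n i))
    where
    K : ℕ → Index S → Pred (Point T) 0ℓ
    K n i y = ¬ ∃ λ j → Basic S j ⊆ Basic S i ×
                        Nbhd T y (λ y′ → ∀ {x} → x ∈ Basic S j → (x , y′) ∉ N n)
    rare-K : ∀ n i → Rare T (K n i)
    rare-K n i b =
      let (j , c) , ⊆ib , disjoint = rare n (i , b)
          x , x∈j = nonempty S j
          y , y∈c = nonempty T c
      in c , (λ y∈ → proj₂ (⊆ib (x∈j , y∈)))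
           , λ y∈ ¬∃ → ¬∃ (j , (λ x∈ → proj₁ (⊆ib (x∈ , y∈c)))
                             , c , y∈ , λ y′∈c x∈ → disjoint (x∈ , y′∈c))

  module _ (S : Space) where

    boundary-rare : ∀ {F : Pred (Point S) 0ℓ} → Open′ S (∁ F) →
                    Rare S (λ x → x ∈ F × ¬ Nbhd S x F)
    boundary-rare {F} ∁F-open i with em {P = ∃ λ x → x ∈ Basic S i × x ∉ F}
    ... | yes (x , x∈i , x∉F) =
      let j , _ , j⊆ = nbhd-∩ S (nbhd-basic S i x∈i) (∁F-open x∉F)
      in j , (λ y∈j → proj₁ (j⊆ y∈j)) , λ y∈j (y∈F , _) → proj₂ (j⊆ y∈j) y∈F
    ... | no i⊆F = i , id , λ x∈i (_ , x∉int) →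
      x∉int (i , x∈i , λ y∈i → byContradiction λ y∉F → i⊆F (_ , y∈i , y∉F))

    -- The closed set of points at which `A` is not locally meagre. By `∖heavy-meagre` it contains
    -- `A` up to a meagre set, so it serves as the hull of `A` in the argument for the Souslin
    -- operation. `Small` is there because meagreness quantifies over families of sets.
    Heavy : Pred (Point S) 0ℓ → Pred (Point S) 0ℓ
    Heavy A x = Small (∀ i → x ∈ Basic S i → ¬ Meagre S (A ∩ Basic S i))

    heavy-adherent : ∀ {A x} {V : Pred (Point S) 0ℓ} → x ∈ Heavy A → Nbhd S x V → ∃ (A ∩ V)
    heavy-adherent heavy (i , x∈i , i⊆V) = byContradiction λ none →
      large heavy i x∈i (∅-meagre S λ (y∈A , y∈i) → none (_ , y∈A , i⊆V y∈i))

    ∁heavy-open : ∀ {A} → Open′ S (∁ (Heavy A))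
    ∁heavy-open light =
      let i , ¬P = ¬∀⇒∃¬ (λ all → light (small all))
          x∈i , meagre = byContradiction λ none →
            ¬P λ x∈i meagre → none (x∈i , meagre)
      in i , x∈i , λ y∈i heavy → large heavy i y∈i meagre

    ∖heavy-meagre : ∀ A → Meagre S (A ∖ Heavy A)
    ∖heavy-meagre A = meagre-⊆ S
      (λ (x∈A , light) →
        let i , ¬P = ¬∀⇒∃¬ (λ all → light (small all))
            x∈i , meagre = byContradiction λ none →
              ¬P λ x∈i meagre → none (x∈i , meagre)
        in i , meagre , x∈A , x∈i)
      (⋃-meagre S (countable S) part-meagre)
      where
      part-meagre : ∀ i → Meagre S (λ x → Meagre S (A ∩ Basic S i) × x ∈ A × x ∈ Basic S i)
      part-meagre i with em {P = Meagre S (A ∩ Basic S i)}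
      ... | yes meagre = meagre-⊆ S proj₂ meagre
      ... | no ¬meagre = ∅-meagre S λ (meagre , _) → ¬meagre meagre

    -- If no basic part of `Basic S i` lies in a single `Heavy (B n)`, these closed sets are all
    -- rare within `Basic S i`. Each `B n` is then meagre there, so `A` is too, and `Basic S i`
    -- contains no heavy point of `A`.
    heavy-⋃-rare : ∀ {A : Pred (Point S) 0ℓ} {B : ℕ → Pred (Point S) 0ℓ} → A ⊆ ⋃ ℕ B →
                   Rare S (Heavy A ∖ ⋃ ℕ (Heavy ∘ B))
    heavy-⋃-rare {A} {B} A⊆B i
      with em {P = ∃₂ λ j n → Basic S j ⊆ Basic S i × Basic S j ⊆ Heavy (B n)}
    ... | yes (j , n , j⊆i , j⊆B) = j , j⊆i , λ x∈j (_ , x∉) → x∉ (n , j⊆B x∈j)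
    ... | no ¬∃ = i , id , λ x∈i (x∈A , _) → large x∈A i x∈i (meagre-⊆ S
        (λ (y∈A , y∈i) → let n , y∈B = A⊆B y∈A in n , (case em of λ where
          (yes heavy) → inj₁ (heavy , y∈i)
          (no light)  → inj₂ (y∈B , light)))
        (⋃-meagre S ℕ-countable λ n →
          ∪-meagre S (rare⇒meagre S (rare n)) (∖heavy-meagre (B n))))
      where
      rare : ∀ n → Rare S (Heavy (B n) ∩ Basic S i)
      rare n k with em {P = ∃ λ x → x ∈ Basic S k × x ∉ Heavy (B n)}
      ... | yes (x , x∈k , light) =
        let j , _ , j⊆ = nbhd-∩ S (nbhd-basic S k x∈k) (∁heavy-open light)
        in j , (λ y∈j → proj₁ (j⊆ y∈j)) , λ y∈j (y∈ , _) → proj₂ (j⊆ y∈j) y∈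
      ... | no k⊆ = k , id , λ x∈k (_ , x∈i) →
        let j , _ , j⊆k , j⊆i = meet S k i x∈k x∈i
        in ¬∃ (j , n , j⊆i , λ y∈j → byContradiction λ light → k⊆ (_ , j⊆k y∈j , light))

  -- Off a meagre set the points of A [] have a branch s with all E (s ↾ k)
  -- containing the point, and the lexicographically least one varies continuously.
  module Souslin (S : Space) (A : List ℕ → Pred (Point S) 0ℓ)
                 (split : ∀ s → A s ⊆ ⋃ ℕ (λ n → A (n ∷ s))) where

    E : List ℕ → Pred (Point S) 0ℓ
    E s = Heavy S (A s)

    Regular : Pred (Point S) 0ℓ
    Regular x = (x ∈ A [] → x ∈ E []) ×
                (∀ s → (x ∈ E s → ∃ λ n → x ∈ E (n ∷ s)) × (x ∈ E s → Nbhd S x (E s)))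

    regular-comeagre : Comeagre S Regular
    regular-comeagre = comeagre-∩ S
      (meagre-⊆ S implication (∖heavy-meagre S (A [])))
      (comeagre-⋂ S List-countable λ s → comeagre-∩ S
        (meagre-⊆ S implication (rare⇒meagre S (heavy-⋃-rare S (split s))))
        (meagre-⊆ S implication (rare⇒meagre S (boundary-rare S (∁heavy-open S)))))
      where
      implication : ∀ {P Q : Set} → ¬ (P → Q) → P × ¬ Q
      implication ¬P→Q = byContradiction λ none →
        ¬P→Q λ p → byContradiction λ ¬q → none (p , ¬q)

    next : Point S → List ℕ → ℕ
    next x s with em {P = ∃ λ n → x ∈ E (n ∷ s)}
    ... | yes found = proj₁ (least found)
    ... | no _      = 0

    next-least : ∀ {x s} → (∃ λ n → x ∈ E (n ∷ s)) →
                 x ∈ E (next x s ∷ s) × (∀ m → m ℕ.< next x s → x ∉ E (m ∷ s))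
    next-least {x} {s} found with em {P = ∃ λ n → x ∈ E (n ∷ s)}
    ... | yes found′ = proj₂ (least found′)
    ... | no none    = contradiction found none

    next-unique : ∀ {x s n} → x ∈ E (n ∷ s) → (∀ m → m ℕ.< n → x ∉ E (m ∷ s)) → next x s ≡ n
    next-unique {x} {s} {n} x∈ below with next-least (n , x∈) | ℕ.<-cmp (next x s) n
    ... | x∈next , _  | tri< next<n _ _ = contradiction x∈next (below _ next<n)
    ... | _           | tri≈ _ eq _     = eq
    ... | _ , minimal | tri> _ _ n<next = contradiction x∈ (minimal n n<next)

    digit : Point S → ℕ → ℕ
    branch : Point S → ℕ → List ℕ
    digit x k = next x (branch x k)
    branch x zero    = []
    branch x (suc k) = digit x k ∷ branch x k

    branch-heavy : ∀ {x} → x ∈ Regular → x ∈ E [] → ∀ k → x ∈ E (branch x k)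
    branch-heavy regular x∈ zero    = x∈
    branch-heavy regular x∈ (suc k) =
      proj₁ (next-least (proj₁ (proj₂ regular _) (branch-heavy regular x∈ k)))

    -- A digit is determined by membership in one `E` and non-membership in finitely many others.
    -- The former persists nearby by regularity, the latter because every `E` is closed.
    branch-continuous : ∀ {x} → x ∈ Regular → x ∈ E [] → ∀ k →
                        Nbhd S x (λ y → branch y k ≡ branch x k)
    branch-continuous regular x∈ zero    = nbhd-always S λ _ → refl
    branch-continuous {x} regular x∈ (suc k) = nbhd-⊆ S
      (λ {y} (eq , y∈ , below) →
        cong₂ _∷_ (trans (cong (next y) eq) (next-unique y∈ below)) eq)
      (nbhd-∩ S (branch-continuous regular x∈ k)
        (nbhd-∩ S (proj₂ (proj₂ regular _) heavy)
          (nbhd-∀< S (digit x k) λ m m< → ∁heavy-open S (minimal m m<))))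
      where
      heavy   = branch-heavy regular x∈ (suc k)
      minimal = proj₂ (next-least (_ , heavy))

-- Relative continuity and generic uniformisation.

ContinuousOn : ∀ {ℓ} (S T : Space) → Pred (Point S) ℓ → (Point S → Point T) → Set ℓ
ContinuousOn S T D f = ∀ {x j} → x ∈ D → f x ∈ Basic T j → Nbhd S x (λ x′ → x′ ∈ D → f x′ ∈ Basic T j)

continuousOn-nbhd : ∀ {ℓ ℓ′} S T {D : Pred (Point S) ℓ} {f x} {V : Pred (Point T) ℓ′} →
  ContinuousOn S T D f → x ∈ D → Nbhd T (f x) V → Nbhd S x (λ x′ → x′ ∈ D → f x′ ∈ V)
continuousOn-nbhd S T cts x∈D (j , fx∈j , j⊆V) =
  nbhd-⊆ S (λ x∈ x∈D → j⊆V (x∈ x∈D)) (cts x∈D fx∈j)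

continuousOn-⊆ : ∀ {ℓ ℓ′} S T {D : Pred (Point S) ℓ} {D′ : Pred (Point S) ℓ′} {f} → D′ ⊆ D →
                 ContinuousOn S T D f → ContinuousOn S T D′ f
continuousOn-⊆ S T D′⊆D cts x∈D′ fx∈j =
  nbhd-⊆ S (λ f∈ x′∈D′ → f∈ (D′⊆D x′∈D′)) (cts (D′⊆D x∈D′) fx∈j)

-- A relation whose fibres lie in a G_δ set ⋂ O and which is closed relative
-- to D × ⋂ O has a domain with the Baire property, on which it admits a
-- section that is continuous on a comeagre set.
module Uniformisation
  (em : ∀ {ℓ} → ExcludedMiddle ℓ) (Z : Space) (T : Uniform) (default : Uniform.Point T)
  (O : ℕ → Pred (Uniform.Point T) 0ℓ) (O-open : ∀ k → Open′ (topology T) (O k))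
  (D : Pred (Point Z) 0ℓ) (D-comeagre : Comeagre Z D)
  (R : Point Z → Uniform.Point T → Set) (R⇒O : ∀ {z t} → R z t → ∀ k → t ∈ O k)
  (R-closed : ∀ {z t} → z ∈ D → (∀ k → t ∈ O k) →
    (∀ k {V : Pred (Point Z) 0ℓ} → Nbhd Z z V →
      ∃₂ λ z′ t′ → z′ ∈ V × Uniform.Close T k t t′ × R z′ t′) → R z t)
  where
  open Category em
  open Uniform T using (Close; close-sym; close-trans; close-≤; centre; complete)

  private
    code : Countable (Uniform.Index T × ℕ)
    code = ×-countable (Uniform.countable T) ℕ-countable

    c : ℕ → Uniform.Point T
    c n = centre (proj₁ (enum code n))

    -- The number `n` codes a centre and a radius. The coded ball around `t` is a margin inside
    -- `O k` that is common to all points of `L k n`, so limits cannot leave `O k`. The exponent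
    -- `3 + k` leaves room for two uses of the triangle inequality before `suc k` is reached.
    L : ℕ → ℕ → Pred (Uniform.Point T) 0ℓ
    L k n t = Close (3 ℕ.+ k) (c n) t × (∀ {t′} → Close (proj₂ (enum code n)) t t′ → t′ ∈ O k)

    L-cover : ∀ {t} → (∀ k → t ∈ O k) → ∀ k → ∃ λ n → t ∈ L k n
    L-cover {t} t∈O k =
      let j , jt   = Uniform.dense T (3 ℕ.+ k) t
          a , ball = Uniform.nbhd⇒ball T (O-open k (t∈O k))
      in index code (j , a) , subst
           (λ (j , a) → Close (3 ℕ.+ k) (centre j) t × (∀ {t′} → Close a t t′ → t′ ∈ O k))
           (sym (enum-index code (j , a))) (jt , ball)

    Fits : List ℕ → Pred (Uniform.Point T) 0ℓ
    Fits []      t = ⊤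
    Fits (n ∷ s) t = t ∈ L (length s) n × t ∈ Fits s

    A : List ℕ → Pred (Point Z) 0ℓ
    A s z = ∃ λ t → R z t × t ∈ Fits s

    split : ∀ s → A s ⊆ ⋃ ℕ (λ n → A (n ∷ s))
    split s (t , Rzt , fits) =
      let n , t∈L = L-cover (R⇒O Rzt) (length s) in n , t , Rzt , t∈L , fits

  open Souslin Z A split

  private
    length-branch : ∀ z k → length (branch z k) ≡ k
    length-branch z zero    = refl
    length-branch z (suc k) = cong suc (length-branch z k)

    fits-lookup : ∀ {z t k} m → k ℕ.< m → t ∈ Fits (branch z m) → t ∈ L k (digit z k)
    fits-lookup {z} {t} (suc m) k<1+m (t∈L , fits) with ℕ.m≤n⇒m<n∨m≡n (ℕ.s≤s⁻¹ k<1+m)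
    ... | inj₁ k<m  = fits-lookup m k<m fits
    ... | inj₂ refl = subst (λ l → t ∈ L l (digit z m)) (length-branch z m) t∈L

    -- The second half is what makes the section continuous: two approximated points sharing the
    -- `k`-th digit are within 2⁻ᵏ of each other.
    Approximated : Point Z → Pred (Uniform.Point T) 0ℓ
    Approximated z t = R z t × (∀ k → Close (suc k) (c (digit z k)) t)

    approximation : ∀ {z} → z ∈ D → z ∈ Regular → z ∈ E [] → ∃ (Approximated z)
    approximation {z} z∈D regular heavy = t , R-closed z∈D t∈O close-R , near
      where
      -- Heaviness yields witnesses only over points near `z`, possibly none over `z` itself.
      -- `R-closed` is what brings the limit back to `z`.
      pick : ∀ m {V : Pred (Point Z) 0ℓ} → Nbhd Z z V →
             ∃₂ λ z′ t′ → z′ ∈ V × R z′ t′ × t′ ∈ Fits (branch z m)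
      pick m V∋z = let z′ , (t′ , R′ , fits) , z′∈V = heavy-adherent Z (branch-heavy regular heavy m) V∋z
                   in z′ , t′ , z′∈V , R′ , fits
      everywhere : Nbhd Z z (λ _ → ⊤)
      everywhere = nbhd-always Z λ _ → tt
      s : ℕ → Uniform.Point T
      s k = c (digit z k)
      s-close : ∀ {k l} → k ℕ.≤ l → Close (2 ℕ.+ k) (s k) (s l)
      s-close {k} {l} k≤l =
        let _ , t′ , _ , _ , fits = pick (suc l) everywhere
        in close-trans (proj₁ (fits-lookup (suc l) (ℕ.s≤s k≤l) fits))
             (close-sym (close-≤ (ℕ.+-monoʳ-≤ 3 k≤l) (proj₁ (fits-lookup (suc l) ℕ.≤-refl fits))))
      limit = complete s λ k → k , λ m n k≤m k≤n →
        close-≤ (ℕ.n≤1+n k) (close-trans (close-sym (s-close k≤m)) (s-close k≤n))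
      t = proj₁ limit
      near : ∀ k → Close (suc k) (s k) t
      near k = let N , close = proj₂ limit (2 ℕ.+ k)
               in close-trans (s-close (ℕ.m≤m⊔n k N)) (close-sym (close _ (ℕ.m≤n⊔m k N)))
      near-fits : ∀ {k t′} m → k ℕ.< m → t′ ∈ Fits (branch z m) → Close k t t′
      near-fits {k} m k<m fits = close-trans (close-sym (near k))
        (close-≤ (ℕ.m≤n+m (suc k) 2) (proj₁ (fits-lookup m k<m fits)))
      close-R : ∀ k {V : Pred (Point Z) 0ℓ} → Nbhd Z z V →
                ∃₂ λ z′ t′ → z′ ∈ V × Close k t t′ × R z′ t′
      close-R k V∋z = let z′ , t′ , z′∈V , R′ , fits = pick (suc k) V∋z
                      in z′ , t′ , z′∈V , near-fits (suc k) ℕ.≤-refl fits , R′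
      t∈O : ∀ k → t ∈ O k
      t∈O k =
        let a = proj₂ (enum code (digit z k))
            -- Past `k`, so that `t′` has its margin in `O k`, and past the exponent `a` of that
            -- margin, so that the limit falls within it.
            m = suc (k ℕ.⊔ a)
            _ , t′ , _ , _ , fits = pick m everywhere
        in proj₂ (fits-lookup m (ℕ.s≤s (ℕ.m≤m⊔n k a)) fits)
             (close-sym (near-fits m (ℕ.s≤s (ℕ.m≤n⊔m k a)) fits))

  abstract

    -- An open set which on `Good` coincides with the domain of `R`, by `domain⇒domain°` and
    -- `section-R`; this is the Baire property of the domain.
    Domain° : Pred (Point Z) 0ℓ
    Domain° z = Nbhd Z z (E [])

    Good : Pred (Point Z) 0ℓ
    Good = D ∩ Regular

    domain°-open : Open′ Z Domain°
    domain°-open = nbhd-interior Z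

    good⊆D : Good ⊆ D
    good⊆D = proj₁

    good-comeagre : Comeagre Z Good
    good-comeagre = comeagre-∩ Z D-comeagre regular-comeagre

    domain⇒domain° : ∀ {z t} → z ∈ Good → R z t → z ∈ Domain°
    domain⇒domain° (_ , regular) Rzt =
      proj₂ (proj₂ regular []) (proj₁ regular (_ , Rzt , tt))

    section : Point Z → Uniform.Point T
    section z with em {P = z ∈ Domain° × ∃ (Approximated z)}
    ... | yes (_ , t , _) = t
    ... | no _            = default

    section-approximated : ∀ {z} → z ∈ Good → z ∈ Domain° → Approximated z (section z)
    section-approximated {z} (z∈D , regular) z∈ with em {P = z ∈ Domain° × ∃ (Approximated z)}
    ... | yes (_ , _ , approximated) = approximated
    ... | no none = contradiction (z∈ , approximation z∈D regular (nbhd-∈ Z z∈)) none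

    section-R : ∀ {z} → z ∈ Good → z ∈ Domain° → R z (section z)
    section-R good z∈ = proj₁ (section-approximated good z∈)

    section-default : ∀ {z} → z ∉ Domain° → section z ≡ default
    section-default {z} z∉ with em {P = z ∈ Domain° × ∃ (Approximated z)}
    ... | yes (z∈ , _) = contradiction z∈ z∉
    ... | no _         = refl

    section-continuous : ContinuousOn Z (topology T) Good section
    section-continuous {z} {j} good@(z∈D , regular) sz∈j with em {P = z ∈ Domain°}
    -- By regularity `z` is not even in the closed set `E []`, so the section is constantly
    -- `default` around it.
    ... | no z∉ = nbhd-⊆ Z (λ {z′} light _ → subst (_∈ Basic (topology T) j)
        (trans (section-default z∉) (sym (section-default (light ∘ nbhd-∈ Z)))) sz∈j)
      (∁heavy-open Z λ heavy → z∉ (proj₂ (proj₂ regular []) heavy))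
    ... | yes z∈ =
      let k , ball = Uniform.nbhd⇒ball T (nbhd-basic (topology T) j sz∈j)
      in nbhd-⊆ Z (λ {z′} (z′∈ , eq) good′ → ball (close-trans
            (close-sym (proj₂ (section-approximated good z∈) k))
            (subst (λ n → Close (suc k) (c n) (section z′)) (∷-injectiveˡ eq)
              (proj₂ (section-approximated good′ z′∈) k))))
          (nbhd-∩ Z (nbhd-interior Z z∈) (branch-continuous regular (nbhd-∈ Z z∈) (suc k)))

-- Topological groups and their actions.

proj₂-openMap : ∀ S T → OpenMap (S ×ₛ T) T proj₂
proj₂-openMap S T {i , j} (x∈i , y∈j) = j , y∈j , λ {y′} y′∈j → (_ , y′) , (x∈i , y′∈j) , refl

inverse-openMap : ∀ S T {f : Point S → Point T} (g : Point T → Point S) →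
  (∀ x → g (f x) ≡ x) → (∀ y → f (g y) ≡ y) → (∀ y → ContinuousAt T S g y) → OpenMap S T f
inverse-openMap S T {f} g gf fg g-cts {i} {x} x∈i = nbhd-⊆ T
  (λ {y} gy∈i → g y , gy∈i , fg y)
  (preimage-basic (g-cts (f x)) (subst (_∈ Basic S i) (sym (gf x)) x∈i))

record TopologicalGroup : Set₁ where
  infixl 7 _∙_
  infix  8 _⁻¹
  field
    uniform : Uniform
  open Uniform uniform public
    using (Close; nbhd⇒ball; nbhd-ball; close-≤)
    renaming (Point to Carrier)
  Gₛ = topology uniform
  field
    _∙_      : Carrier → Carrier → Carrier
    ε        : Carrier
    _⁻¹      : Carrier → Carrier
    isGroup  : IsGroup _≡_ _∙_ ε _⁻¹
    ∙-continuous  : ∀ p → ContinuousAt (Gₛ ×ₛ Gₛ) Gₛ (uncurry _∙_) p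
    ⁻¹-continuous : ∀ g → ContinuousAt Gₛ Gₛ _⁻¹ g

  open IsGroup isGroup public using (assoc; identityˡ; identityʳ; inverseˡ; inverseʳ)

  group : Group 0ℓ 0ℓ
  group = record { isGroup = isGroup }

  open GroupProperties group public
    using (⁻¹-involutive; ⁻¹-anti-homo-∙; ε⁻¹≈ε)

  cancelʳ : ∀ g h → (g ∙ h ⁻¹) ∙ h ≡ g
  cancelʳ g h = trans (assoc g (h ⁻¹) h) (trans (cong (g ∙_) (inverseˡ h)) (identityʳ g))

  cancelʳ′ : ∀ g h → (g ∙ h) ∙ h ⁻¹ ≡ g
  cancelʳ′ g h = trans (assoc g h (h ⁻¹)) (trans (cong (g ∙_) (inverseʳ h)) (identityʳ g))

  quotients : ∀ g h k → (g ∙ h ⁻¹) ∙ (h ∙ k ⁻¹) ≡ g ∙ k ⁻¹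
  quotients g h k = trans (sym (assoc (g ∙ h ⁻¹) h (k ⁻¹))) (cong (_∙ k ⁻¹) (cancelʳ g h))

  quotient-inverse : ∀ g h → (g ∙ h ⁻¹) ⁻¹ ≡ h ∙ g ⁻¹
  quotient-inverse g h = trans (⁻¹-anti-homo-∙ g (h ⁻¹)) (cong (_∙ g ⁻¹) (⁻¹-involutive h))

  quotient-translate : ∀ g h k → (g ∙ k) ∙ (h ∙ k) ⁻¹ ≡ g ∙ h ⁻¹
  quotient-translate g h k = trans (cong ((g ∙ k) ∙_) (⁻¹-anti-homo-∙ h k))
    (trans (sym (assoc (g ∙ k) (k ⁻¹) (h ⁻¹))) (cong (_∙ h ⁻¹) (cancelʳ′ g k)))

  module _ {S : Space} where

    ∙-continuousAt : ∀ {f g x} → ContinuousAt S Gₛ f x → ContinuousAt S Gₛ g x →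
                     ContinuousAt S Gₛ (λ y → f y ∙ g y) x
    ∙-continuousAt f-cts g-cts = ∘-continuousAt (∙-continuous _) (<,>-continuousAt f-cts g-cts)

    ⁻¹-continuousAt : ∀ {f x} → ContinuousAt S Gₛ f x → ContinuousAt S Gₛ (λ y → f y ⁻¹) x
    ⁻¹-continuousAt f-cts = ∘-continuousAt (⁻¹-continuous _) f-cts

  ∙ʳ-continuousAt : ∀ h {g} → ContinuousAt Gₛ Gₛ (_∙ h) g
  ∙ʳ-continuousAt h = ∙-continuousAt id-continuousAt const-continuousAt

  ∙ʳ-openMap : ∀ h → OpenMap Gₛ Gₛ (_∙ h)
  ∙ʳ-openMap h = inverse-openMap Gₛ Gₛ (_∙ h ⁻¹) (λ g → cancelʳ′ g h) (λ g → cancelʳ g h)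
    λ g → ∙ʳ-continuousAt (h ⁻¹)

  Nbhdε : Pred Carrier 0ℓ → Set
  Nbhdε V = Nbhd Gₛ ε V

  cube-root : ∀ V → Nbhdε V → ∃ λ W → Nbhdε W × (∀ {a b c} → a ∈ W → b ∈ W → c ∈ W → (a ∙ b) ∙ c ∈ V)
  cube-root V V∋ε =
    let ((i , j) , k) , ((ε∈i , ε∈j) , ε∈k) , ⊆V = preimage-nbhd ((Gₛ ×ₛ Gₛ) ×ₛ Gₛ) Gₛ
          {x = (ε , ε) , ε}
          (∙-continuousAt (∘-continuousAt (∙-continuous (ε , ε)) proj₁-continuousAt) proj₂-continuousAt)
          (subst (λ g → Nbhd Gₛ g V) (sym (trans (identityʳ (ε ∙ ε)) (identityʳ ε))) V∋ε)
    in Basic Gₛ i ∩ (Basic Gₛ j ∩ Basic Gₛ k)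
     , nbhd-∩ Gₛ (nbhd-basic Gₛ i ε∈i) (nbhd-∩ Gₛ (nbhd-basic Gₛ j ε∈j) (nbhd-basic Gₛ k ε∈k))
     , λ (a∈i , _) (_ , b∈j , _) (_ , _ , c∈k) → ⊆V ((a∈i , b∈j) , c∈k)

  small-quotients : ∀ {V} h → Nbhdε V → ∃ λ b → h ∈ Basic Gₛ b ×
    (∀ {g g′} → g ∈ Basic Gₛ b → g′ ∈ Basic Gₛ b → g ∙ g′ ⁻¹ ∈ V)
  small-quotients {V} h V∋ε =
    let (i , j) , (h∈i , h∈j) , ij⊆V = preimage-nbhd (Gₛ ×ₛ Gₛ) Gₛ {x = h , h}
          (∙-continuousAt proj₁-continuousAt (⁻¹-continuousAt proj₂-continuousAt))
          (subst (λ g → Nbhd Gₛ g V) (sym (inverseʳ h)) V∋ε)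
        b , h∈b , b⊆i , b⊆j = meet Gₛ i j h∈i h∈j
    in b , h∈b , λ g∈b g′∈b → ij⊆V (b⊆i g∈b , b⊆j g′∈b)

  symmetrise : ∀ V → Nbhdε V → Nbhdε (V ∩ ((_⁻¹) ⊢ V))
  symmetrise V V∋ε = nbhd-∩ Gₛ V∋ε (preimage-nbhd Gₛ Gₛ (⁻¹-continuous ε)
    (subst (λ g → Nbhd Gₛ g V) (sym ε⁻¹≈ε) V∋ε))

  -- The Birkhoff-Kakutani base: symmetric sets with the cube of each inside its predecessor, where
  -- cubes serve to halve chains in `chain-bound`. `W 0` is the whole group, which keeps the
  -- resulting distance finite. Intersecting with `Close k ε` makes the sets a base at ε.
  W-nbhd : ℕ → Σ (Pred Carrier 0ℓ) Nbhdε
  root : ∀ k → ∃ λ V → Nbhdε V ×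
    (∀ {a b c} → a ∈ V → b ∈ V → c ∈ V → (a ∙ b) ∙ c ∈ proj₁ (W-nbhd k) ∩ Close k ε)
  W-nbhd zero    = U , nbhd-always Gₛ λ _ → tt
  W-nbhd (suc k) = let V , V∋ε , _ = root k in V ∩ ((_⁻¹) ⊢ V) , symmetrise V V∋ε
  root k = cube-root _ (nbhd-∩ Gₛ (proj₂ (W-nbhd k)) (nbhd-ball k))

  W : ℕ → Pred Carrier 0ℓ
  W k = proj₁ (W-nbhd k)

  W∋ε : ∀ k → Nbhdε (W k)
  W∋ε k = proj₂ (W-nbhd k)

  ε∈W : ∀ k → ε ∈ W k
  ε∈W k = nbhd-∈ Gₛ (W∋ε k)

  W-⁻¹ : ∀ k {g} → g ∈ W k → g ⁻¹ ∈ W k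
  W-⁻¹ zero    _            = tt
  W-⁻¹ (suc k) {g} (g∈ , g⁻¹∈) = g⁻¹∈ , subst (_∈ proj₁ (root k)) (sym (⁻¹-involutive g)) g∈

  W-cube-Close : ∀ k {a b c} → a ∈ W (suc k) → b ∈ W (suc k) → c ∈ W (suc k) →
                 (a ∙ b) ∙ c ∈ W k ∩ Close k ε
  W-cube-Close k (a∈ , _) (b∈ , _) (c∈ , _) =
    proj₂ (proj₂ (root k)) a∈ b∈ c∈

  W-cube : ∀ k {a b c} → a ∈ W (suc k) → b ∈ W (suc k) → c ∈ W (suc k) → (a ∙ b) ∙ c ∈ W k
  W-cube k a∈ b∈ c∈ = proj₁ (W-cube-Close k a∈ b∈ c∈)

  W-∙ : ∀ k {a b} → a ∈ W (suc k) → b ∈ W (suc k) → a ∙ b ∈ W k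
  W-∙ k {a} {b} a∈ b∈ = subst (_∈ W k) (identityʳ (a ∙ b)) (W-cube k a∈ b∈ (ε∈W (suc k)))

  W-⊆ : ∀ k → W (suc k) ⊆ W k
  W-⊆ k {a} a∈ = subst (_∈ W k) (identityʳ a) (W-∙ k a∈ (ε∈W (suc k)))

  W-antitone : ∀ {k l} → k ℕ.≤ l → W l ⊆ W k
  W-antitone {k} {l} k≤l with ℕ.m≤n⇒m<n∨m≡n k≤l
  ... | inj₂ refl = id
  W-antitone {k} {suc l} k≤l | inj₁ k<l = W-antitone (ℕ.s≤s⁻¹ k<l) ∘ W-⊆ l

  W-base : ∀ {V} → Nbhdε V → ∃ λ k → W k ⊆ V
  W-base V∋ε =
    let k , ball = nbhd⇒ball V∋ε
    in suc k , λ {a} a∈ → ball (subst (Close k ε)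
         (trans (identityʳ (a ∙ ε)) (identityʳ a))
         (proj₂ (W-cube-Close k a∈ (ε∈W (suc k)) (ε∈W (suc k)))))

  -- Being right-Cauchy for any, equivalently all, right-invariant compatible metrics.
  RightCauchy′ : (ℕ → Carrier) → Set₁
  RightCauchy′ s = ∀ {V} → Nbhdε V → ∃ λ N → ∀ m n → N ℕ.≤ m → N ℕ.≤ n → s m ∙ s n ⁻¹ ∈ V


record Action (G : TopologicalGroup) : Set₁ where
  open TopologicalGroup G using (_∙_; ε; _⁻¹; Gₛ; inverseˡ; inverseʳ; ⁻¹-continuousAt; RightCauchy′)
  infixr 7 _·_
  field
    uniform : Uniform
  open Uniform uniform public
    using (close-trans; close-sym; close-≤; nbhd⇒ball; nbhd-ball; separated)
    renaming (Point to Carrier; Close to Closeₓ)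
  Xₛ = topology uniform
  field
    _·_          : TopologicalGroup.Carrier G → Carrier → Carrier
    ·-identity   : ∀ x → ε · x ≡ x
    ·-assoc      : ∀ g h x → (g ∙ h) · x ≡ g · (h · x)
    ·-continuous : ∀ p → ContinuousAt (Gₛ ×ₛ Xₛ) Xₛ (uncurry _·_) p

  ·-continuousAt : ∀ {S f g x} → ContinuousAt S Gₛ f x → ContinuousAt S Xₛ g x →
                   ContinuousAt S Xₛ (λ y → f y · g y) x
  ·-continuousAt f-cts g-cts = ∘-continuousAt (·-continuous _) (<,>-continuousAt f-cts g-cts)

  ⁻¹·-cancel : ∀ g x → g ⁻¹ · (g · x) ≡ x
  ⁻¹·-cancel g x = trans (sym (·-assoc (g ⁻¹) g x)) (trans (cong (_· x) (inverseˡ g)) (·-identity x))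

  ·⁻¹-cancel : ∀ g x → g · (g ⁻¹ · x) ≡ x
  ·⁻¹-cancel g x = trans (sym (·-assoc g (g ⁻¹) x)) (trans (cong (_· x) (inverseʳ g)) (·-identity x))

  -- Mutually inverse homeomorphisms whose second components are the action and the inverse action.
  -- They reduce category statements about `g · x` to statements about the projection.
  twist twist⁻¹ : TopologicalGroup.Carrier G × Carrier → TopologicalGroup.Carrier G × Carrier
  twist   (g , x) = g , g · x
  twist⁻¹ (g , x) = g , g ⁻¹ · x

  twist-continuous : ∀ p → ContinuousAt (Gₛ ×ₛ Xₛ) (Gₛ ×ₛ Xₛ) twist p
  twist-continuous p = <,>-continuousAt proj₁-continuousAt (·-continuous p)

  twist⁻¹-continuous : ∀ p → ContinuousAt (Gₛ ×ₛ Xₛ) (Gₛ ×ₛ Xₛ) twist⁻¹ p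
  twist⁻¹-continuous p = <,>-continuousAt proj₁-continuousAt
    (·-continuousAt (⁻¹-continuousAt proj₁-continuousAt) proj₂-continuousAt)

  twist⁻¹∘twist : ∀ p → twist⁻¹ (twist p) ≡ p
  twist⁻¹∘twist (g , x) = cong (g ,_) (⁻¹·-cancel g x)

  twist∘twist⁻¹ : ∀ p → twist (twist⁻¹ p) ≡ p
  twist∘twist⁻¹ (g , x) = cong (g ,_) (·⁻¹-cancel g x)

  OrbitEq′ : Rel Carrier 0ℓ
  OrbitEq′ x y = ∃ λ g → g · x ≡ y

  orbit-sym : ∀ {x y} → OrbitEq′ x y → OrbitEq′ y x
  orbit-sym {x} (g , refl) = g ⁻¹ , ⁻¹·-cancel g x

  orbit-trans : ∀ {x y z} → OrbitEq′ x y → OrbitEq′ y z → OrbitEq′ x z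
  orbit-trans {x} (g , refl) (h , refl) = h ∙ g , ·-assoc h g x

  RightEmbeds′ : Rel Carrier (lsuc 0ℓ)
  RightEmbeds′ x x′ = ∃ λ g → RightCauchy′ g ×
    (∀ {V : Pred Carrier 0ℓ} → Nbhd Xₛ x V → ∃ λ N → ∀ n → N ℕ.≤ n → g n · x′ ∈ V)

  module _ (em : ∀ {ℓ} → ExcludedMiddle ℓ) where
    open Category em

    twist-comeagre : ∀ {ℓ} {A : Pred _ ℓ} → Comeagre (Gₛ ×ₛ Xₛ) A → Comeagre (Gₛ ×ₛ Xₛ) (twist ⊢ A)
    twist-comeagre = preimage-comeagre _ _ {f = twist} twist-continuous
      (inverse-openMap _ _ twist⁻¹ twist⁻¹∘twist twist∘twist⁻¹ twist⁻¹-continuous)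

    twist⁻¹-comeagre : ∀ {ℓ} {A : Pred _ ℓ} → Comeagre (Gₛ ×ₛ Xₛ) A → Comeagre (Gₛ ×ₛ Xₛ) (twist⁻¹ ⊢ A)
    twist⁻¹-comeagre = preimage-comeagre _ _ {f = twist⁻¹} twist⁻¹-continuous
      (inverse-openMap _ _ twist twist∘twist⁻¹ twist⁻¹∘twist twist-continuous)

    proj₂-comeagre : ∀ {ℓ} {A : Pred Carrier ℓ} → Comeagre Xₛ A → Comeagre (Gₛ ×ₛ Xₛ) (proj₂ ⊢ A)
    proj₂-comeagre = preimage-comeagre (Gₛ ×ₛ Xₛ) Xₛ {f = proj₂}
      (λ _ → proj₂-continuousAt) (proj₂-openMap Gₛ Xₛ)

    orbit-comeagre : ∀ {ℓ} {A : Pred Carrier ℓ} → Comeagre Xₛ A →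
                     Comeagre Xₛ (λ x → Comeagre Gₛ (λ g → g · x ∈ A))
    orbit-comeagre {A = A} cA = sections-comeagre Gₛ Xₛ {M = λ (g , x) → g · x ∈ A}
      (twist-comeagre {A = proj₂ ⊢ A} (proj₂-comeagre cA))

    orbit⁻¹-comeagre : ∀ {ℓ} {A : Pred Carrier ℓ} → Comeagre Xₛ A →
                       Comeagre Xₛ (λ x → Comeagre Gₛ (λ g → g ⁻¹ · x ∈ A))
    orbit⁻¹-comeagre {A = A} cA = sections-comeagre Gₛ Xₛ {M = λ (g , x) → g ⁻¹ · x ∈ A}
      (twist⁻¹-comeagre {A = proj₂ ⊢ A} (proj₂-comeagre cA))

-- Transfer of right-embeddings along a generically continuous cocycle.

-- The name is loose: `cocycle` is merely a choice of elements carrying `f x` to `f (g · x)`, with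
-- no product rule. Elements between values of `f` are therefore formed as quotients of two choices
-- over the same point.
module Cocycle
  (em : ∀ {ℓ} → ExcludedMiddle ℓ) (G H : TopologicalGroup) (X : Action G) (Y : Action H)
  (f : Action.Carrier X → Action.Carrier Y) (D : Pred (Action.Carrier X) 0ℓ)
  (D-comeagre : Comeagre (Action.Xₛ X) D)
  (f-continuous : ContinuousOn (Action.Xₛ X) (Action.Xₛ Y) D f)
  (f-hom : ∀ {g x} → x ∈ D → Action._·_ X g x ∈ D → Action.OrbitEq′ Y (f x) (f (Action._·_ X g x)))
  (M : Pred (TopologicalGroup.Carrier G × Action.Carrier X) 0ℓ)
  (M-comeagre : Comeagre (TopologicalGroup.Gₛ G ×ₛ Action.Xₛ X) M)
  (cocycle : TopologicalGroup.Carrier G × Action.Carrier X → TopologicalGroup.Carrier H)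
  (cocycle-continuous :
    ContinuousOn (TopologicalGroup.Gₛ G ×ₛ Action.Xₛ X) (TopologicalGroup.Gₛ H) M cocycle)
  (cocycle-R : ∀ {g x} → (g , x) ∈ M →
               Action._·_ Y (cocycle (g , x)) (f x) ≡ f (Action._·_ X g x))
  where
  open Category em
  private
    module G = TopologicalGroup G
    module H = TopologicalGroup H
    module X = Action X
    module Y = Action Y
    open X using (_·_; Xₛ)
    open G using (_∙_; ε; _⁻¹; Gₛ)
    open H using () renaming (Gₛ to Hₛ)
    open Y using () renaming (Xₛ to Yₛ)

    GX GGX : Space
    GX = Gₛ ×ₛ Xₛ
    GGX = Gₛ ×ₛ (Gₛ ×ₛ Xₛ)
    shift : Point GGX → Point GX
    shift (s , (a′ , v)) = s ∙ a′ , a′ ⁻¹ · v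
    -- `shift` sends (ε , a , x) to the base pair (a , u), and pairs (e , a′⁻¹v) arise with `s` = e
    -- a′⁻¹. Continuity here turns control of the cocycle near (a , u) into conditions on `s`, `a′`
    -- and `v` separately.
    shift-continuous : ∀ p → ContinuousAt GGX GX shift p
    shift-continuous p = <,>-continuousAt
      (G.∙-continuousAt proj₁-continuousAt a′-continuous)
      (X.·-continuousAt
        (G.⁻¹-continuousAt a′-continuous)
        (∘-continuousAt {T = Gₛ ×ₛ Xₛ} {f = proj₂} {g = proj₂} proj₂-continuousAt proj₂-continuousAt))
      where
      a′-continuous : ContinuousAt GGX Gₛ (λ (_ , (a′ , _)) → a′) p
      a′-continuous = ∘-continuousAt {T = Gₛ ×ₛ Xₛ} {f = proj₂} {g = proj₁}
        proj₁-continuousAt proj₂-continuousAt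

    -- The two generic conditions in `C₁` are the needs of one stage over `v`: a `b` with (b , b⁻¹v)
    -- in `M`, and enough good elements over b⁻¹v for the next stage to be linked to it. `C` adds
    -- that generic translates of the point qualify as `v`.
    M′ C₁ : Pred X.Carrier (lsuc 0ℓ)
    M′ u = Comeagre Gₛ (λ a → (a , u) ∈ M)
    C₁ v = v ∈ D × Comeagre Gₛ (λ a → (a , a ⁻¹ · v) ∈ M) × Comeagre Gₛ (λ a → a ⁻¹ · v ∈ M′)

  C : Pred X.Carrier (lsuc 0ℓ)
  C x = x ∈ C₁ × Comeagre Gₛ (λ c → c · x ∈ C₁)

  private
    C₁-comeagre : Comeagre Xₛ C₁
    C₁-comeagre = comeagre-∩ Xₛ D-comeagre (comeagre-∩ Xₛ
      (sections-comeagre Gₛ Xₛ (X.twist⁻¹-comeagre em M-comeagre))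
      (X.orbit⁻¹-comeagre em (sections-comeagre Gₛ Xₛ M-comeagre)))

  C-comeagre : Comeagre Xₛ C
  C-comeagre = comeagre-∩ Xₛ C₁-comeagre (X.orbit-comeagre em C₁-comeagre)

  C⊆D : C ⊆ D
  C⊆D ((x∈D , _) , _) = x∈D

  module _ {x x′ : X.Carrier} (x∈C : x ∈ C) (x′∈C : x′ ∈ C) (embeds : X.RightEmbeds′ x x′) where
    private
      g : ℕ → G.Carrier
      g = proj₁ embeds

      -- A good substitute for (ε , x), which need not lie in `M`.
      base : ∃ λ a → (a , a ⁻¹ · x) ∈ M × ⊤
      base = BaireCategory.comeagre-meets em G.uniform {x = ε} {A = λ a → (a , a ⁻¹ · x) ∈ M}
               {V = λ _ → ⊤} (proj₁ (proj₂ (proj₁ x∈C))) (nbhd-always Gₛ λ _ → tt)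

      a : G.Carrier
      a = proj₁ base

      u : X.Carrier
      u = a ⁻¹ · x

      record Scale (k : ℕ) : Set where
        field
          i : Index Gₛ
          j : Index Gₛ
          l : Index Xₛ
          ε∈i : ε ∈ Basic Gₛ i
          a∈j : a ∈ Basic Gₛ j
          x∈l : x ∈ Basic Xₛ l
          cocycle-close : ∀ {a′ v e} → a′ ∈ Basic Gₛ j → v ∈ Basic Xₛ l → e ∙ a′ ⁻¹ ∈ Basic Gₛ i →
            (a′ , a′ ⁻¹ · v) ∈ M → (e , a′ ⁻¹ · v) ∈ M →
            cocycle (e , a′ ⁻¹ · v) H.∙ cocycle (a′ , a′ ⁻¹ · v) H.⁻¹ ∈ H.W (suc k)
          f-close : ∀ {v} → v ∈ Basic Xₛ l → v ∈ D → Y.Closeₓ k (f x) (f v)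

      abstract
        scale : ∀ k → Scale k
        scale k = record
          { i = i ; j = j ; l = l′ ; ε∈i = ε∈i ; a∈j = a∈j ; x∈l = x∈l′
          -- Both cocycle values fall into the same small set `B`: one as the shift of e a′⁻¹, the
          -- other as the shift of ε.
          ; cocycle-close = λ {a′} {v} {e} a′∈j v∈l′ ea′⁻¹∈i good good′ → B-quotients
              (subst (λ g → (g , a′ ⁻¹ · v) ∈ M → cocycle (g , a′ ⁻¹ · v) ∈ B) (G.cancelʳ e a′)
                (ijl⊆ {e ∙ a′ ⁻¹ , a′ , v} (ea′⁻¹∈i , a′∈j , proj₁ (l′⊆ v∈l′))) good′)
              (subst (λ g → (g , a′ ⁻¹ · v) ∈ M → cocycle (g , a′ ⁻¹ · v) ∈ B) (G.identityˡ a′)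
                (ijl⊆ {ε , a′ , v} (ε∈i , a′∈j , proj₁ (l′⊆ v∈l′))) good)
          ; f-close = λ v∈l′ → proj₂ (l′⊆ v∈l′)
          }
          where
          quotients : ∃ λ b → cocycle (a , u) ∈ Basic Hₛ b ×
            (∀ {h h′} → h ∈ Basic Hₛ b → h′ ∈ Basic Hₛ b → h H.∙ h′ H.⁻¹ ∈ H.W (suc k))
          quotients = H.small-quotients (cocycle (a , u)) (H.W∋ε (suc k))
          B : Pred H.Carrier 0ℓ
          B = Basic Hₛ (proj₁ quotients)
          B-quotients : ∀ {h h′} → h ∈ B → h′ ∈ B → h H.∙ h′ H.⁻¹ ∈ H.W (suc k)
          B-quotients = proj₂ (proj₂ quotients)
          near-au : Nbhd GX (a , u) (λ z → z ∈ M → cocycle z ∈ B)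
          near-au = cocycle-continuous (proj₁ (proj₂ base)) (proj₁ (proj₂ quotients))
          near : Nbhd GGX (ε , (a , x)) (λ p → shift p ∈ M → cocycle (shift p) ∈ B)
          near = preimage-nbhd GGX GX {V = λ z → z ∈ M → cocycle z ∈ B} (shift-continuous (ε , (a , x)))
            (subst (λ b → Nbhd GX (b , u) (λ z → z ∈ M → cocycle z ∈ B)) (sym (G.identityˡ a)) near-au)
          i j : Index Gₛ
          i = proj₁ (proj₁ near)
          j = proj₁ (proj₂ (proj₁ near))
          l : Index Xₛ
          l = proj₂ (proj₂ (proj₁ near))
          ε∈i : ε ∈ Basic Gₛ i
          ε∈i = proj₁ (proj₁ (proj₂ near))
          a∈j : a ∈ Basic Gₛ j
          a∈j = proj₁ (proj₂ (proj₁ (proj₂ near)))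
          x∈l : x ∈ Basic Xₛ l
          x∈l = proj₂ (proj₂ (proj₁ (proj₂ near)))
          ijl⊆ : ∀ {p} → p ∈ Basic GGX (proj₁ near) → shift p ∈ M → cocycle (shift p) ∈ B
          ijl⊆ = proj₂ (proj₂ near)
          inner : Nbhd Xₛ x (λ v → v ∈ Basic Xₛ l × (v ∈ D → Y.Closeₓ k (f x) (f v)))
          inner = nbhd-∩ Xₛ (nbhd-basic Xₛ l x∈l)
            (continuousOn-nbhd Xₛ Yₛ f-continuous (C⊆D x∈C) (Y.nbhd-ball k))
          l′ : Index Xₛ
          l′ = proj₁ inner
          x∈l′ : x ∈ Basic Xₛ l′
          x∈l′ = proj₁ (proj₂ inner)
          l′⊆ : ∀ {v} → v ∈ Basic Xₛ l′ → v ∈ Basic Xₛ l × (v ∈ D → Y.Closeₓ k (f x) (f v))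
          l′⊆ = proj₂ (proj₂ inner)

      open Scale

      -- The terms of g are perturbed to c, and a to b, so that the cocycle is only
      -- evaluated at points of M tending to (a , u). Hence the quotients of its
      -- values, which carry f (c · x′) to its successor, tend to ε.
      record Stage (k : ℕ) : Set₁ where
        field
          c b     : G.Carrier
        v = c · x′
        w = b ⁻¹ · v
        field
          v∈C₁    : v ∈ C₁
          v∈l     : v ∈ Basic Xₛ (l (scale k))
          tail    : ∃ λ N → ∀ n → N ℕ.≤ n → g n ∙ c ⁻¹ ∈ Basic Gₛ (i (scale k))
          b∈j     : b ∈ Basic Gₛ (j (scale k))
          bw∈M    : (b , w) ∈ M
          w∈M′    : w ∈ M′

      open Stage

      abstract
        -- `Γ` and `V` are the generic and the open condition by which a stage is linked to its
        -- predecessor. The element `c` is a generic point close to a late term `g n`, which is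
        -- possible because `V` is a neighbourhood of all late terms.
        stage-in : ∀ k {Γ : Pred G.Carrier 0ℓ} {V : Pred G.Carrier 0ℓ} → Comeagre Gₛ Γ →
          (∃ λ N → ∀ n → N ℕ.≤ n → Nbhd Gₛ (g n) V) → Σ (Stage k) λ σ → c σ ∈ Γ × c σ ∈ V
        stage-in k {Γ} {V} Γ-comeagre (N , V-near) = record
            { c    = c′
            ; b    = proj₁ perturbation
            ; v∈C₁ = c′x′∈C₁
            ; v∈l  = proj₁ (proj₂ (proj₂ (proj₂ choice)))
            ; tail = n , tail-in
            ; b∈j  = proj₂ (proj₂ perturbation)
            ; bw∈M = proj₁ (proj₁ (proj₂ perturbation))
            ; w∈M′ = proj₂ (proj₁ (proj₂ perturbation))
            } , proj₁ (proj₁ (proj₂ choice)) , proj₁ (proj₂ (proj₂ choice))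
          where
          I : Pred G.Carrier 0ℓ
          I = Basic Gₛ (i (scale k))
          L : Pred X.Carrier 0ℓ
          L = Basic Xₛ (l (scale k))
          product : Nbhd (Gₛ ×ₛ Gₛ) (ε , ε) (λ (s , s′) → s ∙ s′ ∈ I)
          product = preimage-nbhd (Gₛ ×ₛ Gₛ) Gₛ {V = I} (G.∙-continuous (ε , ε))
            (subst (λ g → Nbhd Gₛ g I) (sym (G.identityˡ ε)) (nbhd-basic Gₛ (i (scale k)) (ε∈i (scale k))))
          P Q : Pred G.Carrier 0ℓ
          P = Basic Gₛ (proj₁ (proj₁ product))
          Q = Basic Gₛ (proj₂ (proj₁ product))
          PQ⊆I : ∀ {s s′} → s ∈ P → s′ ∈ Q → s ∙ s′ ∈ I
          PQ⊆I s∈P s′∈Q = proj₂ (proj₂ product) (s∈P , s′∈Q)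
          eventually : ∃ λ N → ∀ m n → N ℕ.≤ m → N ℕ.≤ n → g m ∙ g n ⁻¹ ∈ P
          eventually = proj₁ (proj₂ embeds)
            (nbhd-basic Gₛ (proj₁ (proj₁ product)) (proj₁ (proj₁ (proj₂ product))))
          converges : ∃ λ N → ∀ n → N ℕ.≤ n → g n · x′ ∈ L
          converges = proj₂ (proj₂ embeds) (nbhd-basic Xₛ (l (scale k)) (x∈l (scale k)))
          n N₁ N₂ : ℕ
          N₁ = proj₁ eventually
          N₂ = proj₁ converges
          n  = N ℕ.⊔ (N₁ ℕ.⊔ N₂)
          ≤₁ : N₁ ℕ.≤ n
          ≤₁ = ℕ.≤-trans (ℕ.m≤m⊔n N₁ N₂) (ℕ.m≤n⊔m N _)
          ≤₂ : N₂ ℕ.≤ n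
          ≤₂ = ℕ.≤-trans (ℕ.m≤n⊔m N₁ N₂) (ℕ.m≤n⊔m N _)
          around : Nbhd Gₛ (g n) (V ∩ (λ c → c · x′ ∈ L × g n ∙ c ⁻¹ ∈ Q))
          around = nbhd-∩ Gₛ (V-near n (ℕ.m≤m⊔n N _)) (nbhd-∩ Gₛ
            (preimage-basic {f = λ c → c · x′} (X.·-continuousAt id-continuousAt const-continuousAt)
              (proj₂ converges n ≤₂))
            (preimage-basic {f = λ c → g n ∙ c ⁻¹}
              (G.∙-continuousAt const-continuousAt (G.⁻¹-continuous (g n)))
              (subst (_∈ Q) (sym (G.inverseʳ (g n))) (proj₂ (proj₁ (proj₂ product))))))
          choice : ∃ ((Γ ∩ (λ c → c · x′ ∈ C₁)) ∩ (V ∩ (λ c → c · x′ ∈ L × g n ∙ c ⁻¹ ∈ Q)))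
          choice = BaireCategory.comeagre-meets em G.uniform {A = Γ ∩ (λ c → c · x′ ∈ C₁)}
            (comeagre-∩ Gₛ Γ-comeagre (proj₂ x′∈C)) around
          c′ : G.Carrier
          c′ = proj₁ choice
          c′x′∈C₁ : c′ · x′ ∈ C₁
          c′x′∈C₁ = proj₂ (proj₁ (proj₂ choice))
          tail-in : ∀ m → n ℕ.≤ m → g m ∙ c′ ⁻¹ ∈ I
          -- The quotient by `c′` splits at `g n`: right-Cauchyness puts the first factor in `P`,
          -- closeness of `c′` to `g n` puts the second in `Q`.
          tail-in m n≤m = subst (_∈ I) (G.quotients (g m) (g n) c′)
            (PQ⊆I (proj₂ eventually m n (ℕ.≤-trans ≤₁ n≤m) ≤₁) (proj₂ (proj₂ (proj₂ (proj₂ choice)))))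
          perturbation : ∃ (((λ b → (b , b ⁻¹ · (c′ · x′)) ∈ M) ∩ (λ b → b ⁻¹ · (c′ · x′) ∈ M′))
                            ∩ Basic Gₛ (j (scale k)))
          perturbation = BaireCategory.comeagre-meets em G.uniform
            {A = (λ b → (b , b ⁻¹ · (c′ · x′)) ∈ M) ∩ (λ b → b ⁻¹ · (c′ · x′) ∈ M′)}
            (comeagre-∩ Gₛ (proj₁ (proj₂ c′x′∈C₁)) (proj₂ (proj₂ c′x′∈C₁)))
            (nbhd-basic Gₛ (j (scale k)) (a∈j (scale k)))

      advance : ∀ {k} → Stage k → Stage (suc k) → G.Carrier
      advance σ τ = c τ ∙ (c σ ⁻¹ ∙ b σ)

      Linked : ∀ {k} → Stage k → Stage (suc k) → Set
      Linked {k} σ τ = (advance σ τ , w σ) ∈ M × c τ ∙ c σ ⁻¹ ∈ Basic Gₛ (i (scale k))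

      next-stage : ∀ {k} (σ : Stage k) → Σ (Stage (suc k)) (Linked σ)
      next-stage {k} σ = stage-in (suc k)
        -- Generically many elements are good over `w σ`. Since `advance` is a right translate of
        -- the next `c`, a right translation turns this into a generic condition on that `c`.
        (preimage-comeagre Gₛ Gₛ (λ _ → G.∙ʳ-continuousAt _) (G.∙ʳ-openMap (c σ ⁻¹ ∙ b σ)) (w∈M′ σ))
        (let N , tail-in = tail σ in N , λ n N≤n →
          preimage-basic (G.∙ʳ-continuousAt (c σ ⁻¹)) (tail-in n N≤n))

      stage : ∀ k → Stage k
      stage zero    = proj₁ (stage-in zero {U} {U} (∅-meagre Gₛ λ x∉ → x∉ tt)
                        (0 , λ _ _ → nbhd-always Gₛ λ _ → tt))
      stage (suc k) = proj₁ (next-stage (stage k))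

      y : ℕ → Y.Carrier
      y k = f (v (stage k))

      transition : ℕ → H.Carrier
      transition k = cocycle (advance (stage k) (stage (suc k)) , w (stage k))
                     H.∙ cocycle (b (stage k) , w (stage k)) H.⁻¹

      advance-w : ∀ {k} (σ : Stage k) (τ : Stage (suc k)) → advance σ τ · w σ ≡ v τ
      advance-w σ τ = trans (X.·-assoc (c τ) _ (w σ)) (cong (c τ ·_)
        (trans (X.·-assoc (c σ ⁻¹) (b σ) (w σ)) (trans (cong (c σ ⁻¹ ·_) (X.·⁻¹-cancel (b σ) (v σ)))
          (X.⁻¹·-cancel (c σ) x′))))

      cocycle-v : ∀ {k} (σ : Stage k) → cocycle (b σ , w σ) Y.· f (w σ) ≡ f (v σ)
      cocycle-v σ = trans (cocycle-R (bw∈M σ)) (cong f (X.·⁻¹-cancel (b σ) (v σ)))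

      cocycle-advance : ∀ {k} (σ : Stage k) (τ : Stage (suc k)) → (advance σ τ , w σ) ∈ M →
                        cocycle (advance σ τ , w σ) Y.· f (w σ) ≡ f (v τ)
      cocycle-advance σ τ good = trans (cocycle-R good) (cong f (advance-w σ τ))

      transport : ∀ {h h′ z y y′} → h Y.· z ≡ y → h′ Y.· z ≡ y′ → (h′ H.∙ h H.⁻¹) Y.· y ≡ y′
      transport {h} {h′} {z} refl refl =
        trans (sym (Y.·-assoc (h′ H.∙ h H.⁻¹) h z)) (cong (Y._· z) (H.cancelʳ h′ h))

      transition-y : ∀ k → transition k Y.· y k ≡ y (suc k)
      transition-y k = transport (cocycle-v (stage k))
        (cocycle-advance (stage k) (stage (suc k)) (proj₁ (proj₂ (next-stage (stage k)))))

      advance-b⁻¹ : ∀ {k} (σ : Stage k) (τ : Stage (suc k)) →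
                    advance σ τ ∙ b σ ⁻¹ ≡ c τ ∙ c σ ⁻¹
      advance-b⁻¹ σ τ = trans (cong (_∙ b σ ⁻¹) (sym (G.assoc (c τ) (c σ ⁻¹) (b σ))))
        (G.cancelʳ′ (c τ ∙ c σ ⁻¹) (b σ))

      linked-small : ∀ {k} (σ : Stage k) (τ : Stage (suc k)) → Linked σ τ →
        cocycle (advance σ τ , w σ) H.∙ cocycle (b σ , w σ) H.⁻¹ ∈ H.W (suc k)
      linked-small {k} σ τ (good , near) = cocycle-close (scale k) (b∈j σ) (v∈l σ)
        (subst (_∈ Basic Gₛ (i (scale k))) (sym (advance-b⁻¹ σ τ)) near) (bw∈M σ) good

      transition-small : ∀ k → transition k ∈ H.W (suc k)
      transition-small k = linked-small (stage k) (stage (suc k)) (proj₂ (next-stage (stage k)))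

      start : ∃ λ h → h Y.· f x′ ≡ y 0
      -- No smallness is required of the first element, as it cancels in all quotients
      -- `h m ∙ h n ⁻¹`.
      start = f-hom (C⊆D x′∈C) (proj₁ (v∈C₁ (stage 0)))

      h : ℕ → H.Carrier
      h zero    = proj₁ start
      h (suc k) = transition k H.∙ h k

      h-y : ∀ k → h k Y.· f x′ ≡ y k
      h-y zero    = proj₂ start
      h-y (suc k) = trans (Y.·-assoc (transition k) (h k) (f x′))
        (trans (cong (transition k Y.·_) (h-y k)) (transition-y k))

      -- The earliest transition is split off, not the latest: the remaining product then lies in
      -- `W (suc n)` like that transition, and one product of two such elements costs one level.
      h-cauchy : ∀ n d → h (d ℕ.+ n) H.∙ h n H.⁻¹ ∈ H.W n
      h-cauchy n zero    = subst (_∈ H.W n) (sym (H.inverseʳ (h n))) (H.ε∈W n)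
      h-cauchy n (suc d) = subst (_∈ H.W n) (H.quotients _ _ _) (H.W-∙ n
        (subst (λ m → h m H.∙ h (suc n) H.⁻¹ ∈ H.W (suc n)) (ℕ.+-suc d n) (h-cauchy (suc n) d))
        (subst (_∈ H.W (suc n)) (sym (H.cancelʳ′ (transition n) (h n))) (transition-small n)))

      pair : ∀ {k m n} → k ℕ.≤ m → k ℕ.≤ n → h m H.∙ h n H.⁻¹ ∈ H.W k
      h-close : ∀ {n m} → n ℕ.≤ m → h m H.∙ h n H.⁻¹ ∈ H.W n
      h-close {n} {m} n≤m = subst (λ l → h l H.∙ h n H.⁻¹ ∈ H.W n) (ℕ.m∸n+n≡m n≤m) (h-cauchy n (m ℕ.∸ n))

      pair {k} {m} {n} k≤m k≤n with ℕ.≤-total n m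
      ... | inj₁ n≤m = H.W-antitone k≤n (h-close n≤m)
      ... | inj₂ m≤n = subst (_∈ H.W k) (H.quotient-inverse (h n) (h m))
                         (H.W-⁻¹ k (H.W-antitone k≤m (h-close m≤n)))

    f-rightEmbeds : Y.RightEmbeds′ (f x) (f x′)
    f-rightEmbeds = h
      , (λ V∋ε → let k , W⊆V = H.W-base V∋ε in k , λ m n k≤m k≤n → W⊆V (pair k≤m k≤n))
      , λ V∋fx → let k , ball = Y.nbhd⇒ball V∋fx in k , λ n k≤n → ball (Y.close-≤ k≤n
          (subst (Y.Closeₓ n (f x)) (sym (h-y n))
            (f-close (scale n) (v∈l (stage n)) (proj₁ (v∈C₁ (stage n))))))

-- The cocycle of a generically continuous homomorphism.

module GenericHomomorphism
  (em : ∀ {ℓ} → ExcludedMiddle ℓ) (G H : TopologicalGroup) (X : Action G) (Y : Action H)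
  (f : Action.Carrier X → Action.Carrier Y) (D : Pred (Action.Carrier X) 0ℓ)
  (D-comeagre : Comeagre (Action.Xₛ X) D)
  (f-continuous : ContinuousOn (Action.Xₛ X) (Action.Xₛ Y) D f)
  (f-hom : ∀ {g x} → x ∈ D → Action._·_ X g x ∈ D → Action.OrbitEq′ Y (f x) (f (Action._·_ X g x)))
  where
  open Category em
  private
    module G = TopologicalGroup G
    module H = TopologicalGroup H
    module X = Action X
    module Y = Action Y
    open X using (_·_; Xₛ)
    open G using (_∙_; ε; _⁻¹; Gₛ)
    open H using () renaming (Gₛ to Hₛ)
    open Y using () renaming (Xₛ to Yₛ)

    GX : Space
    GX = Gₛ ×ₛ Xₛ

    D₂ : Pred (Point GX) 0ℓ
    D₂ (g , x) = x ∈ D × g · x ∈ D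

    R : Point GX → H.Carrier → Set
    R (g , x) h = h Y.· f x ≡ f (g · x)

    D₂-comeagre : Comeagre GX D₂
    D₂-comeagre = comeagre-∩ GX (X.proj₂-comeagre em D-comeagre)
      (X.twist-comeagre em (X.proj₂-comeagre em D-comeagre))

    -- Membership in `D₂` is built in because closedness is tested along nearby points, and `f` is
    -- continuous only relative to `D`.
    R₂ : Point GX → H.Carrier → Set
    R₂ z h = z ∈ D₂ × R z h

    R₂-closed : ∀ {z h} → z ∈ D₂ → ((k : ℕ) → h ∈ U) →
      (∀ k {V : Pred (Point GX) 0ℓ} → Nbhd GX z V →
        ∃₂ λ z′ h′ → z′ ∈ V × H.Close k h h′ × R₂ z′ h′) → R₂ z h
    R₂-closed {g , x} {h} z∈ _ close = z∈ , Y.separated λ k →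
      let (i , j) , (h∈i , fx∈j) , ij⊆ = preimage-nbhd (Hₛ ×ₛ Yₛ) Yₛ (Y.·-continuous (h , f x))
            (Y.nbhd-ball (suc k))
          l , ball = H.nbhd⇒ball (nbhd-basic Hₛ i h∈i)
          (g′ , x′) , h′ , (fx′∈ , fgx′∈) , hh′ , (x′∈D , gx′∈D) , eq = close l
            (nbhd-∩ GX
              (preimage-nbhd GX Xₛ proj₂-continuousAt (f-continuous (proj₁ z∈) fx∈j))
              (preimage-nbhd GX Xₛ (X.·-continuous (g , x))
                (continuousOn-nbhd Xₛ Yₛ f-continuous (proj₂ z∈) (Y.nbhd-ball (suc k)))))
      in Y.close-trans (subst (Y.Closeₓ (suc k) (h Y.· f x)) eq (ij⊆ (ball hh′ , fx′∈ x′∈D)))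
           (Y.close-sym (fgx′∈ gx′∈D))

    module M = Uniformisation em GX H.uniform H.ε (λ _ → U) (λ _ _ → nbhd-always Hₛ λ _ → tt)
      D₂ D₂-comeagre R₂ (λ _ _ → tt) R₂-closed

    cocycle-R : ∀ {g x} → (g , x) ∈ M.Good → M.section (g , x) Y.· f x ≡ f (g · x)
    cocycle-R good =
      let x∈D , gx∈D = M.good⊆D good
          h , eq = f-hom x∈D gx∈D
      in proj₂ (M.section-R good (M.domain⇒domain° good ((x∈D , gx∈D) , eq)))

  private
    module Result = Cocycle em G H X Y f D D-comeagre f-continuous f-hom
      M.Good M.good-comeagre M.section M.section-continuous cocycle-R

  abstract

    C : Pred X.Carrier (lsuc 0ℓ)
    C = Result.C

    C-comeagre : Comeagre Xₛ C
    C-comeagre = Result.C-comeagre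

    C⊆D : C ⊆ D
    C⊆D = Result.C⊆D

    f-rightEmbeds : ∀ {x x′} → x ∈ C → x′ ∈ C → X.RightEmbeds′ x x′ → Y.RightEmbeds′ (f x) (f x′)
    f-rightEmbeds = Result.f-rightEmbeds

-- A compatible right-invariant metric on a topological group.

2^-antitone : ∀ {k l} → k ℕ.≤ l → 2^- l ℚ.≤ 2^- k
2^-antitone {k} {l} k≤l with ℕ.m≤n⇒m<n∨m≡n k≤l
... | inj₂ refl = ℚ.≤-refl
2^-antitone {k} {suc l} k≤l | inj₁ k<l = ℚ.≤-trans
  (subst₂ ℚ._≤_ (ℚ.+-identityʳ (2^- (suc l))) (2^-halves l)
    (ℚ.+-monoʳ-≤ (2^- (suc l)) (ℚ.<⇒≤ (2^-positive (suc l)))))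
  (2^-antitone (ℕ.s≤s⁻¹ k<l))

2^-<⇒> : ∀ {k l} → 2^- l ℚ.< 2^- k → k ℕ.< l
2^-<⇒> {k} {l} l<k with k ℕ.<? l
... | yes k<l = k<l
... | no k≮l  = contradiction (ℚ.<-≤-trans l<k (2^-antitone (ℕ.≮⇒≥ k≮l))) (ℚ.<-irrefl refl)

-- The Birkhoff–Kakutani metric.
module ChainMetric (G : TopologicalGroup) where
  open TopologicalGroup G

  -- Links are measured by `y ∙ x ⁻¹`, which right translations leave unchanged; this makes the
  -- infimum of the weights right-invariant.
  data Chain : Carrier → Carrier → ℚ → Set where
    []   : ∀ {x} → Chain x x 0ℚ
    link : ∀ k {x y z w} → y ∙ x ⁻¹ ∈ W k → Chain y z w → Chain x z (2^- k ℚ.+ w)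

  size : ∀ {x y w} → Chain x y w → ℕ
  size []           = 0
  size (link _ _ c) = suc (size c)

  weight-nonneg : ∀ {x y w} → Chain x y w → 0ℚ ℚ.≤ w
  weight-nonneg []           = ℚ.≤-refl
  weight-nonneg (link k _ c) =
    ℚ.+-mono-≤ (ℚ.<⇒≤ (2^-positive k)) (weight-nonneg c)

  append : ∀ {x y z v w} → Chain x y v → Chain y z w → Chain x z (v ℚ.+ w)
  append {w = w} [] c = subst (Chain _ _) (sym (ℚ.+-identityˡ w)) c
  append (link k e c) c′ = subst (Chain _ _) (sym (ℚ.+-assoc (2^- k) _ _)) (link k e (append c c′))

  single : ∀ k {x y} → y ∙ x ⁻¹ ∈ W k → Chain x y (2^- k)
  single k e = subst (Chain _ _) (ℚ.+-identityʳ (2^- k)) (link k e [])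

  reverse : ∀ {x y w} → Chain x y w → Chain y x w
  reverse [] = []
  reverse (link k {x} {y} {w = w} e c) = subst (Chain _ _) (ℚ.+-comm w (2^- k))
    (append (reverse c) (single k (subst (_∈ W k) (quotient-inverse y x) (W-⁻¹ k e))))

  translate : ∀ {x y w} g → Chain x y w → Chain (x ∙ g) (y ∙ g) w
  translate g [] = []
  translate g (link k {x} {y} e c) =
    link k (subst (_∈ W k) (sym (quotient-translate y x g)) e) (translate g c)

  -- The chain is cut at the first link where its weight reaches θ.
  data Split (θ : ℚ) {x y w} (c : Chain x y w) : Set where
    light : w ℚ.< θ → Split θ c
    cut   : ∀ {p q v u} k (c₁ : Chain x p v) (c₂ : Chain q y u) → q ∙ p ⁻¹ ∈ W k →
            v ℚ.+ (2^- k ℚ.+ u) ≡ w → v ℚ.< θ → θ ℚ.≤ v ℚ.+ 2^- k →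
            size c₁ ℕ.< size c → size c₂ ℕ.< size c → Split θ c

  split : ∀ {θ x y w} → 0ℚ ℚ.< θ → (c : Chain x y w) → Split θ c
  split 0<θ [] = light 0<θ
  split {θ} 0<θ (link k {w = w} e c) with 2^- k ℚ.<? θ
  ... | no 2^-k≮θ = cut k [] c e (ℚ.+-identityˡ _) 0<θ
        (ℚ.≤-trans (ℚ.≮⇒≥ 2^-k≮θ) (ℚ.≤-reflexive (sym (ℚ.+-identityˡ _)))) (ℕ.s≤s ℕ.z≤n) ℕ.≤-refl
  ... | yes 2^-k<θ with split {θ ℚ.- 2^- k} (subst (ℚ._< θ ℚ.- 2^- k) (ℚ.+-inverseʳ (2^- k))
                                (ℚ.+-monoˡ-< (ℚ.- 2^- k) 2^-k<θ)) c
  ...   | light w< = light (subst (2^- k ℚ.+ w ℚ.<_) (p+[q-p] (2^- k) θ) (ℚ.+-monoʳ-< (2^- k) w<))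
  ...   | cut {v = v} l c₁ c₂ e′ eq v<θ θ≤ s₁ s₂ = cut l (link k e c₁) c₂ e′
            (trans (ℚ.+-assoc (2^- k) v _) (cong (2^- k ℚ.+_) eq))
            (subst (2^- k ℚ.+ v ℚ.<_) (p+[q-p] (2^- k) θ) (ℚ.+-monoʳ-< (2^- k) v<θ))
            (subst₂ ℚ._≤_ (p+[q-p] (2^- k) θ) (sym (ℚ.+-assoc (2^- k) v (2^- l))) (ℚ.+-monoʳ-≤ (2^- k) θ≤))
            (ℕ.s≤s s₁) (ℕ.m≤n⇒m≤1+n s₂)

  -- The chain is cut where its weight reaches half of 2⁻ᵏ. The parts before and after the cut link
  -- weigh less than half, and the link itself weighs less than 2⁻ᵏ, so its index exceeds `k`. All
  -- three quotients thus lie in `W (suc k)`, and the cube of that set is inside `W k`. A chain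
  -- lighter than half has no cut; there the first link and the rest suffice.
  chain-bound : ∀ n k {x y w} (c : Chain x y w) → size c ℕ.≤ n → w ℚ.< 2^- k → y ∙ x ⁻¹ ∈ W k
  chain-bound n k {x} [] _ _ = subst (_∈ W k) (sym (inverseʳ x)) (ε∈W k)
  chain-bound (suc n) k {x} {z} {w} c@(link m {y = y} {w = w′} e c′) (ℕ.s≤s c′≤n) w<
    with split {2^- (suc k)} (2^-positive (suc k)) c
  ... | light w<′ = subst (_∈ W k) (quotients z y x) (W-∙ k
          (chain-bound n (suc k) c′ c′≤n (ℚ.≤-<-trans w′≤w w<′))
          (W-antitone (ℕ.<⇒≤ (2^-<⇒> (ℚ.≤-<-trans 2^-m≤w w<′))) e))
    where
    w′≤w : w′ ℚ.≤ w
    w′≤w = subst (ℚ._≤ w) (ℚ.+-identityˡ w′) (ℚ.+-monoˡ-≤ w′ (ℚ.<⇒≤ (2^-positive m)))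
    2^-m≤w : 2^- m ℚ.≤ w
    2^-m≤w = subst (ℚ._≤ w) (ℚ.+-identityʳ (2^- m)) (ℚ.+-monoʳ-≤ (2^- m) (weight-nonneg c′))
  ... | cut {p} {q} {v} {u} l c₁ c₂ e′ eq v<θ θ≤ s₁ s₂ = subst (_∈ W k)
          (trans (cong (_∙ (p ∙ x ⁻¹)) (quotients z q p)) (quotients z p x))
          (W-cube k
            (chain-bound n (suc k) c₂ (ℕ.≤-trans (ℕ.s≤s⁻¹ s₂) c′≤n) u<)
            (W-antitone (2^-<⇒> 2^-l<) e′)
            (chain-bound n (suc k) c₁ (ℕ.≤-trans (ℕ.s≤s⁻¹ s₁) c′≤n) v<θ))
    where
    total : v ℚ.+ (2^- l ℚ.+ u) ℚ.< 2^- k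
    total = subst (ℚ._< 2^- k) (sym eq) w<
    2^-l< : 2^- l ℚ.< 2^- k
    2^-l< = ℚ.≤-<-trans (subst₂ ℚ._≤_ (trans (ℚ.+-identityˡ _) (ℚ.+-identityʳ (2^- l))) refl
      (ℚ.+-mono-≤ (weight-nonneg c₁) (ℚ.+-monoʳ-≤ (2^- l) (weight-nonneg c₂)))) total
    u< : u ℚ.< 2^- (suc k)
    u< with u ℚ.<? 2^- (suc k)
    ... | yes u<θ = u<θ
    ... | no u≮θ  = contradiction (ℚ.≤-<-trans
            (subst₂ ℚ._≤_ (2^-halves k) (ℚ.+-assoc v (2^- l) u) (ℚ.+-mono-≤ θ≤ (ℚ.≮⇒≥ u≮θ))) total)
            (ℚ.<-irrefl refl)

  d : Carrier → Carrier → ℝ≥0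
  d x y = record
    { Above     = λ q → ∃ λ w → Chain x y w × w ℚ.< q
    -- `W 0` is the whole group, so one link joins any two points.
    ; inhabited = 2^- 0 ℚ.+ 2^- 0 , 2^- 0 , single 0 tt
                , subst (ℚ._< 2^- 0 ℚ.+ 2^- 0) (ℚ.+-identityʳ (2^- 0)) (ℚ.+-monoʳ-< (2^- 0) (2^-positive 0))
    ; positive  = λ (w , c , w<q) → ℚ.≤-<-trans (weight-nonneg c) w<q
    ; upward    = λ p<q (w , c , w<p) → w , c , ℚ.<-trans w<p p<q
    ; rounded   = λ (w , c , w<q) → let p , w<p , p<q = ℚ.<-dense w<q in p , p<q , w , c , w<p
    }

  d-single : ∀ k {x y} → y ∙ x ⁻¹ ∈ W k → ∀ {q} → 2^- k ℚ.< q → d x y <ℚ q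
  d-single k e k<q = 2^- k , single k e , k<q

  d-bound : ∀ k {x y} → d x y <ℚ 2^- k → y ∙ x ⁻¹ ∈ W k
  d-bound k (w , c , w<) = chain-bound (size c) k c ℕ.≤-refl w<

  quotient≡ε : ∀ {x y} → y ∙ x ⁻¹ ≡ ε → x ≡ y
  quotient≡ε {x} {y} eq = trans (sym (identityˡ x)) (trans (cong (_∙ x) (sym eq)) (cancelʳ y x))

  d-isMetric : IsMetric d
  d-isMetric = record
    { isSemiMetric = record
      { isQuasiSemiMetric = record
        { isPreMetric = record
          { isProtoMetric = record
            { isPartialOrder  = record
              { isPreorder = record
                { isEquivalence = record
                  { refl  = id , id
                  ; sym   = λ (r⊆s , s⊆r) → s⊆r , r⊆s
                  ; trans = λ (r⊆s , s⊆r) (s⊆t , t⊆s) → s⊆t ∘ r⊆s , s⊆r ∘ t⊆s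
                  }
                ; reflexive = proj₂
                ; trans     = λ s⊆r t⊆s → s⊆r ∘ t⊆s
                }
              ; antisym = λ s⊆r r⊆s → r⊆s , s⊆r
              }
            ; ≈-isEquivalence = isEquivalence
            ; cong            = λ { refl refl → id , id }
            ; nonNegative     = λ {x} {y} → ℝ≥0.positive (d x y)
            }
          ; ≈⇒0 = λ { {x} refl → ℝ≥0.positive (d x x) , λ 0<q → 0ℚ , [] , 0<q }
          }
        ; 0⇒≈ = λ {x} {y} (_ , 0⊆d) → quotient≡ε (sym (Uniform.separated uniform λ k →
            let l , W⊆ball = W-base (nbhd-ball k) in W⊆ball (d-bound l {x} {y} (0⊆d (2^-positive l)))))
        }
      ; sym = λ x y → (λ (w , c , w<q) → w , reverse c , w<q) , (λ (w , c , w<q) → w , reverse c , w<q)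
      }
    ; triangle = λ x y z (a , b , (v , c , v<a) , (w , c′ , w<b) , a+b≤q) →
        v ℚ.+ w , append c c′ , ℚ.<-≤-trans (ℚ.+-mono-< v<a w<b) a+b≤q
    }

  d-invariant : ∀ g h k → d (g ∙ k) (h ∙ k) ≃ d g h
  d-invariant g h k =
      (λ (w , c , w<q) → w
        , subst₂ (λ a b → Chain a b w) (cancelʳ′ g k) (cancelʳ′ h k) (translate (k ⁻¹) c) , w<q)
    , (λ (w , c , w<q) → w , translate k c , w<q)

  open′⇒metricOpen : ∀ {V : Pred Carrier 0ℓ} → Open′ Gₛ V → MetricOpen d V
  open′⇒metricOpen {V} V-open {x} x∈V =
    let k , W⊆ = W-base (preimage-nbhd Gₛ Gₛ {V = V} (∙ʳ-continuousAt x)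
                   (subst (λ g → Nbhd Gₛ g V) (sym (identityˡ x)) (V-open x∈V)))
    in 2^- k , 2^-positive k , λ y d< → subst (_∈ V) (cancelʳ y x) (W⊆ (d-bound k {x} {y} d<))

  metricOpen⇒open′ : ∀ {V : Pred Carrier 0ℓ} → MetricOpen d V → Open′ Gₛ V
  metricOpen⇒open′ {V} V-open {x} x∈V =
    let δ , 0<δ , ball = V-open x∈V
        k , k<δ = 2^-archimedean 0<δ
    in nbhd-⊆ Gₛ (λ {y} y∈ → ball y (d-single k y∈ k<δ))
         (preimage-nbhd Gₛ Gₛ {V = W k} (∙ʳ-continuousAt (x ⁻¹))
           (subst (λ g → Nbhd Gₛ g (W k)) (sym (inverseʳ x)) (W∋ε k)))

  d-cauchy : ∀ {s} → RightCauchy′ s → Cauchy d s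
  d-cauchy cauchy δ 0<δ =
    let k , k<δ = 2^-archimedean 0<δ
        N , close = cauchy (W∋ε k)
    in N , λ m n N≤m N≤n → d-single k (close n m N≤n N≤m) k<δ

-- A section up to orbits on the saturated image.

-- The uniformised relation pairs `y` with both a point `x` of ⋂ O and a group element taking `f x`
-- to `y`. Keeping the group element makes the relation closed relative to ⋂ O × H; the orbit
-- relation alone would not be.
module OrbitSection
  (em : ∀ {ℓ} → ExcludedMiddle ℓ) (T : Uniform) (H : TopologicalGroup) (Y : Action H)
  (x₀ : Uniform.Point T) (f : Uniform.Point T → Action.Carrier Y)
  (O : ℕ → Pred (Uniform.Point T) 0ℓ) (O-open : ∀ k → Open′ (topology T) (O k))
  (f-continuous : ContinuousOn (topology T) (Action.Xₛ Y) (λ x → ∀ k → x ∈ O k) f)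
  where
  private
    module T = Uniform T
    module H = TopologicalGroup H
    module Y = Action Y
    open H using () renaming (Gₛ to Hₛ)
    open Y using () renaming (Xₛ to Yₛ)
    TH : Uniform
    TH = T ×ᵤ H.uniform

    O′ : ℕ → Pred (T.Point × H.Carrier) 0ℓ
    O′ k (x , _) = x ∈ O k

    O′-open : ∀ k → Open′ (topology TH) (O′ k)
    O′-open k x∈O = let m , ball = T.nbhd⇒ball (O-open k x∈O)
                    in Uniform.ball⇒nbhd TH m λ (x-close , _) → ball x-close

    R : Y.Carrier → T.Point × H.Carrier → Set
    R y (x , h) = (∀ k → x ∈ O k) × h Y.· f x ≡ y

    R-closed : ∀ {y t} → y ∈ (λ _ → ⊤) → (∀ k → t ∈ O′ k) →
      (∀ k {V : Pred Y.Carrier 0ℓ} → Nbhd Yₛ y V →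
        ∃₂ λ y′ t′ → y′ ∈ V × Uniform.Close TH k t t′ × R y′ t′) → R y t
    R-closed {y} {x , h} _ x∈O close = x∈O , Y.separated λ k →
      let (i , j) , (h∈i , fx∈j) , ij⊆ = preimage-nbhd (Hₛ ×ₛ Yₛ) Yₛ
            {V = Y.Closeₓ (suc k) (h Y.· f x)} (Y.·-continuous (h , f x)) (Y.nbhd-ball (suc k))
          m , h-ball = H.nbhd⇒ball (nbhd-basic Hₛ i h∈i)
          l , x-ball = T.nbhd⇒ball (f-continuous x∈O fx∈j)
          y′ , (x′ , h′) , y′∈ , (xx′ , hh′) , x′∈O , eq = close (m ℕ.⊔ l)
            {V = Y.Closeₓ (suc k) y} (Y.nbhd-ball (suc k))
      in Y.close-trans
           (subst (Y.Closeₓ (suc k) (h Y.· f x)) eq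
             (ij⊆ {h′ , f x′} ( h-ball (H.close-≤ (ℕ.m≤m⊔n m l) hh′)
                              , x-ball (T.close-≤ (ℕ.m≤n⊔m m l) xx′) x′∈O)))
           (Y.close-sym y′∈)

    module S = Uniformisation em Yₛ TH (x₀ , H.ε) O′ O′-open
      (λ _ → ⊤) (∅-meagre Yₛ λ ¬⊤ → ¬⊤ tt) R proj₁ R-closed

  Saturation : Pred Y.Carrier 0ℓ
  Saturation y = ∃ λ x → (∀ k → x ∈ O k) × Y.OrbitEq′ (f x) y

  Domain° Good : Pred Y.Carrier 0ℓ
  Domain° = S.Domain°
  Good = S.Good

  section : Y.Carrier → T.Point
  section y = proj₁ (S.section y)

  abstract

    domain°-open : Open′ Yₛ Domain°
    domain°-open = S.domain°-open

    good-comeagre : Comeagre Yₛ Good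
    good-comeagre = S.good-comeagre

    saturation⇒domain° : ∀ {y} → y ∈ Good → y ∈ Saturation → y ∈ Domain°
    saturation⇒domain° good (x , x∈O , h , eq) = S.domain⇒domain° {t = x , h} good (x∈O , eq)

    section-∈ : ∀ {y} → y ∈ Good → y ∈ Domain° → ∀ k → section y ∈ O k
    section-∈ good y∈ = proj₁ (S.section-R good y∈)

    section-orbit : ∀ {y} → y ∈ Good → y ∈ Domain° → Y.OrbitEq′ (f (section y)) y
    section-orbit good y∈ = _ , proj₂ (S.section-R good y∈)

    section-default : ∀ {y} → y ∉ Domain° → section y ≡ x₀
    section-default y∉ = cong proj₁ (S.section-default y∉)

    section-continuous : ContinuousOn Yₛ (topology T) Good section
    section-continuous {y} {j} good sy∈j =
      let m , ball = T.nbhd⇒ball (nbhd-basic (topology T) j sy∈j)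
      in continuousOn-nbhd Yₛ (topology TH) {V = λ t → proj₁ t ∈ Basic (topology T) j}
           S.section-continuous good
           (Uniform.ball⇒nbhd TH m λ (x-close , _) → ball x-close)

-- Reductions preserve and reflect right-embeddings generically.

module GenericReduction
  (em : ∀ {ℓ} → ExcludedMiddle ℓ) (G H : TopologicalGroup) (X : Action G) (Y : Action H)
  (x₀ : Action.Carrier X) (f : Action.Carrier X → Action.Carrier Y)
  (D : Pred (Action.Carrier X) 0ℓ) (D-comeagre : Comeagre (Action.Xₛ X) D)
  (f-continuous : ContinuousOn (Action.Xₛ X) (Action.Xₛ Y) D f)
  (preserving : ∀ {A : Pred (Action.Carrier Y) 0ℓ} →
                Meagre (Action.Xₛ Y) A → Meagre (Action.Xₛ X) (f ⊢ A))
  (hom : ∀ {x x′} → Action.OrbitEq′ X x x′ → Action.OrbitEq′ Y (f x) (f x′))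
  (reflects : ∀ {x x′} → Action.OrbitEq′ Y (f x) (f x′) → Action.OrbitEq′ X x x′)
  where
  open Category em
  private
    module X = Action X
    module Y = Action Y
    open X using (Xₛ)
    open Y using () renaming (Xₛ to Yₛ)

    Gδ = comeagre⊇Gδ Xₛ D-comeagre
    O : ℕ → Pred X.Carrier 0ℓ
    O = proj₁ Gδ
    ⋂O : Pred X.Carrier 0ℓ
    ⋂O x = ∀ k → x ∈ O k

    ⋂O⊆D : ⋂O ⊆ D
    ⋂O⊆D = proj₂ (proj₂ (proj₂ Gδ))

    -- The hypothesis speaks of sets in the lowest universe; it is applied to the union of the rare
    -- sets covering the complement.
    preserving′ : ∀ {ℓ} {A : Pred Y.Carrier ℓ} → Comeagre Yₛ A → Comeagre Xₛ (f ⊢ A)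
    preserving′ (N , rare , ∁A⊆N) = meagre-⊆ Xₛ ∁A⊆N (preserving (N , rare , id))

    module Forward = GenericHomomorphism em G H X Y f D D-comeagre f-continuous
      (λ {g} _ _ → hom (g , refl))

    module S = OrbitSection em X.uniform H Y x₀ f O (proj₁ (proj₂ Gδ))
      (continuousOn-⊆ Xₛ Yₛ ⋂O⊆D f-continuous)

    domain°-invariant : ∀ {h y} → y ∈ S.Good → h Y.· y ∈ S.Good → y ∈ S.Domain° → h Y.· y ∈ S.Domain°
    domain°-invariant {h} good good′ y∈ = S.saturation⇒domain° good′
      (_ , S.section-∈ good y∈ , Y.orbit-trans (S.section-orbit good y∈) (h , refl))

    -- On `Domain°` this is where `f` reflecting orbits is used. Off it both values are the default
    -- `x₀`, because among good points `Domain°` is the invariant saturation.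
    section-hom : ∀ {h y} → y ∈ S.Good → h Y.· y ∈ S.Good →
                  X.OrbitEq′ (S.section y) (S.section (h Y.· y))
    section-hom {h} {y} good good′ with em {P = y ∈ S.Domain°}
    ... | yes y∈ = reflects (Y.orbit-trans (S.section-orbit good y∈)
            (Y.orbit-trans (h , refl)
              (Y.orbit-sym (S.section-orbit good′ (domain°-invariant good good′ y∈)))))
    ... | no y∉ = TopologicalGroup.ε G , trans (X.·-identity _)
            (trans (S.section-default y∉) (sym (S.section-default λ hy∈ → y∉
              (subst (_∈ S.Domain°) (Y.⁻¹·-cancel h y)
                (domain°-invariant good′ (subst (_∈ S.Good) (sym (Y.⁻¹·-cancel h y)) good) hy∈)))))

    module Backward = GenericHomomorphism em H G Y X S.section S.Good S.good-comeagre
      S.section-continuous section-hom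

  abstract

    -- The last condition is comeagre because `f` pulls meagre sets back to meagre sets; otherwise
    -- `f` might map into the set where the section is uncontrolled. Lying in ⋂ O puts `f x` in the
    -- saturation on which the section works.
    C : Pred X.Carrier (lsuc 0ℓ)
    C x = x ∈ ⋂O × x ∈ Forward.C × f x ∈ Backward.C

    C⊆D : C ⊆ D
    C⊆D (x∈O , _) = ⋂O⊆D x∈O

    C-comeagre : Comeagre Xₛ C
    C-comeagre = comeagre-∩ Xₛ (proj₁ (proj₂ (proj₂ Gδ)))
      (comeagre-∩ Xₛ Forward.C-comeagre (preserving′ Backward.C-comeagre))

    rightEmbeds-preserved : ∀ {x x′} → x ∈ C → x′ ∈ C →
                            X.RightEmbeds′ x x′ → Y.RightEmbeds′ (f x) (f x′)
    rightEmbeds-preserved (_ , x∈ , _) (_ , x′∈ , _) = Forward.f-rightEmbeds x∈ x′∈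

    section-inverse : ∀ {x} → x ∈ C → X.OrbitEq′ (S.section (f x)) x
    section-inverse {x} (x∈O , _ , fx∈) = reflects (S.section-orbit good
      (S.saturation⇒domain° good (x , x∈O , TopologicalGroup.ε H , Y.·-identity (f x))))
      where
      good : f x ∈ S.Good
      good = Backward.C⊆D fx∈

    rightEmbeds-reflected : ∀ {x x′} → x ∈ C → x′ ∈ C → Y.RightEmbeds′ (f x) (f x′) →
      ∃₂ λ z z′ → X.OrbitEq′ z x × X.OrbitEq′ z′ x′ × X.RightEmbeds′ z z′
    rightEmbeds-reflected x∈@(_ , _ , fx∈) x′∈@(_ , _ , fx′∈) embeds =
      _ , _ , section-inverse x∈ , section-inverse x′∈ , Backward.f-rightEmbeds fx∈ fx′∈ embeds

  private
    Gδ′ = comeagre⊇Gδ Xₛ C-comeagre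

    module S′ = OrbitSection em X.uniform H Y x₀ f (proj₁ Gδ′) (proj₁ (proj₂ Gδ′))
      (continuousOn-⊆ Xₛ Yₛ (λ x∈ → C⊆D (proj₂ (proj₂ (proj₂ Gδ′)) x∈)) f-continuous)

  abstract

    Image : Pred Y.Carrier 0ℓ
    Image = S′.Saturation

    image-C : ∀ {y} → y ∈ Image → ∃ λ x → x ∈ C × Y.OrbitEq′ (f x) y
    image-C (x , x∈O , fx∼y) = x , proj₂ (proj₂ (proj₂ Gδ′)) x∈O , fx∼y

    image-invariant : ∀ h {y} → y ∈ Image → h Y.· y ∈ Image
    image-invariant h (x , x∈O , fx∼y) = x , x∈O , Y.orbit-trans fx∼y (h , refl)

    -- On the comeagre set `Good` of the second uniformisation, the saturation and the open set
    -- `Domain°` have the same points.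
    image-baire : ∃ λ (V : Pred Y.Carrier 0ℓ) →
                  Open′ Yₛ V × Meagre Yₛ ((Image ∖ V) ∪ (V ∖ Image))
    image-baire = S′.Domain° , S′.domain°-open , meagre-⊆ Yₛ
      (λ { (inj₁ (y∈ , y∉)) good → y∉ (S′.saturation⇒domain° good y∈)
         ; (inj₂ (y∈ , y∉)) good → y∉ (_ , S′.section-∈ good y∈ , S′.section-orbit good y∈) })
      S′.good-comeagre

    -- The preimage of `Image` contains a comeagre set. Were `Image` meagre, that preimage would be
    -- meagre too, and so would the whole of X, against the Baire category theorem.
    image-nonmeagre : ¬ Meagre Yₛ Image
    image-nonmeagre meagre = proj₁ (proj₂ (BaireCategory.comeagre-meets em X.uniform
      {x = x₀} {A = λ _ → ⊥} {V = λ _ → ⊤} X-meagre (nbhd-always Xₛ λ _ → tt)))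
      where
      X-meagre : Comeagre Xₛ (λ _ → ⊥)
      X-meagre = meagre-⊆ Xₛ
        (λ {x} _ → case em {P = ∀ k → x ∈ proj₁ Gδ′ k} of λ where
          (yes x∈) → inj₂ (x , x∈ , TopologicalGroup.ε H , Y.·-identity (f x))
          (no x∉)  → inj₁ x∉)
        (∪-meagre Xₛ (proj₁ (proj₂ (proj₂ Gδ′))) (preserving meagre))

-- Translation from Polish groups and Polish G-spaces.

topologyOf : PolishSpace → Space
topologyOf P = topology (Metric.uniform P)

abstract
  ⊗-continuousAt : ∀ P Q W {h : PolishSpace.Carrier P × PolishSpace.Carrier Q → PolishSpace.Carrier W} →
    Continuous (PolishSpace.Open P ⊗ PolishSpace.Open Q) (PolishSpace.Open W) h → ∀ p →
    ContinuousAt (topologyOf P ×ₛ topologyOf Q) (topologyOf W) h p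
  ⊗-continuousAt P Q W {h} cts p = continuous λ {j} → near j
    where
    near : ∀ j → h p ∈ Basic (topologyOf W) j →
           Nbhd (topologyOf P ×ₛ topologyOf Q) p (h ⊢ Basic (topologyOf W) j)
    near j hp∈j with cts (Metric.basic-open W j) {p} hp∈j
    ... | V , V′ , V-open , V′-open , (x∈V , y∈V′) , V×V′⊆ =
      let k , x∈k , k⊆V  = V-nbhd
          l , y∈l , l⊆V′ = V′-nbhd
      in (k , l) , (x∈k , y∈l) , λ (x∈ , y∈) → V×V′⊆ (k⊆V x∈ , l⊆V′ y∈)
      where
      V-nbhd : Nbhd (topologyOf P) (proj₁ p) V
      V-nbhd = Metric.open⇒nbhd P V-open x∈V
      V′-nbhd : Nbhd (topologyOf Q) (proj₂ p) V′
      V′-nbhd = Metric.open⇒nbhd Q V′-open y∈V′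

  ⁻¹-continuousAt : ∀ G g → ContinuousAt (topologyOf (PolishGroup.space G))
                      (topologyOf (PolishGroup.space G)) (PolishGroup._⁻¹ G) g
  ⁻¹-continuousAt G g = continuous λ {j} g⁻¹∈j →
    Metric.open⇒nbhd space (⁻¹-continuous (Metric.basic-open space j)) g⁻¹∈j
    where open PolishGroup G

topologicalGroup : PolishGroup → TopologicalGroup
topologicalGroup G = record
  { uniform       = Metric.uniform space
  ; _∙_           = _∙_
  ; ε             = ε
  ; _⁻¹           = _⁻¹
  ; isGroup       = isGroup
  ; ∙-continuous  = ⊗-continuousAt space space space ∙-continuous
  ; ⁻¹-continuous = ⁻¹-continuousAt G
  }
  where open PolishGroup G

module _ (G : PolishGroup) where
  private
    module G = PolishGroup G
    module T = TopologicalGroup (topologicalGroup G)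

  rightCauchy⇒ : ∀ {s} → G.RightCauchy s → T.RightCauchy′ s
  rightCauchy⇒ {s} (d , (_ , compatible) , invariant , cauchy) (i , ε∈i , i⊆V) =
    let δ , 0<δ , ball = Equivalence.to (compatible _) (Metric.basic-open G.space i) ε∈i
        N , close = cauchy δ 0<δ
    in N , λ m n N≤m N≤n → i⊆V (ball (s m G.∙ s n G.⁻¹)
         (proj₁ (invariant G.ε (s m G.∙ s n G.⁻¹) (s n)) (subst₂ (λ a b → d a b <ℚ δ)
           (sym (T.identityˡ (s n))) (sym (T.cancelʳ (s m) (s n))) (close n m N≤n N≤m))))

  -- The definition demands an actual right-invariant compatible metric, and the chain metric
  -- supplies one.
  rightCauchy⇐ : ∀ {s} → T.RightCauchy′ s → G.RightCauchy s
  rightCauchy⇐ cauchy = M.d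
    , (M.d-isMetric , λ V → mk⇔
        (λ V-open {x} → M.open′⇒metricOpen {V} (Metric.open⇒nbhd G.space V-open) {x})
        (λ V-open → Metric.nbhd⇒open G.space (M.metricOpen⇒open′ {V} V-open)))
    , M.d-invariant , M.d-cauchy cauchy
    where module M = ChainMetric (topologicalGroup G)

  action : PolishGSpace G → Action (topologicalGroup G)
  action X = record
    { uniform      = Metric.uniform space
    ; _·_          = _·_
    ; ·-identity   = ·-identity
    ; ·-assoc      = ·-assoc
    ; ·-continuous = ⊗-continuousAt G.space space space ·-continuous
    }
    where open PolishGSpace X

  module _ (X : PolishGSpace G) where
    private
      module X = PolishGSpace X
      module A = Action (action X)

    rightEmbeds⇒ : ∀ {x x′} → X.RightEmbeds x x′ → A.RightEmbeds′ x x′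
    rightEmbeds⇒ {x} {x′} (g , cauchy , converges) = g , rightCauchy⇒ cauchy , converges′
      where
      converges′ : ∀ {V : Pred X.Carrier 0ℓ} → Nbhd A.Xₛ x V → ∃ λ N → ∀ n → N ℕ.≤ n → g n X.· x′ ∈ V
      converges′ (i , x∈i , i⊆V) = let N , in-i = converges (Metric.basic-open X.space i) x∈i
                                   in N , λ n N≤n → i⊆V (in-i n N≤n)

    rightEmbeds⇐ : ∀ {x x′} → A.RightEmbeds′ x x′ → X.RightEmbeds x x′
    rightEmbeds⇐ (g , cauchy , converges) = g , rightCauchy⇐ cauchy
      , λ V-open x∈V → converges (Metric.open⇒nbhd X.space V-open x∈V)

    rightEmbeds-refl : ∀ x → X.RightEmbeds x x
    rightEmbeds-refl x = (λ _ → G.ε)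
      , rightCauchy⇐ (λ {V} V∋ε → 0 , λ _ _ _ _ → subst (_∈ V) (sym (T.inverseʳ G.ε)) (nbhd-∈ T.Gₛ V∋ε))
      , λ {V} _ x∈V → 0 , λ _ _ → subst (_∈ V) (sym (X.·-identity x)) x∈V

    rightEmbeds-resp : ∀ {x y x′ y′} → X.OrbitEq x y → X.OrbitEq x′ y′ →
                       X.RightEmbeds x x′ → X.RightEmbeds y y′
    rightEmbeds-resp x∼y x′∼y′ =
      proj₂ (RightEmbeds-resp-OrbitEq G X) x∼y ∘ proj₁ (RightEmbeds-resp-OrbitEq G X) x′∼y′

-- Dimension and the two obstructions.

module _ (em : ∀ {ℓ} → ExcludedMiddle ℓ) where
  open Category em

  abstract
    -- Removing the countably many meagre differences between preimages of basic sets and their open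
    -- approximations leaves a set on which the two agree.
    baireMeasurable⇒continuousOn : ∀ P Q {f} → BaireMeasurable P Q f →
      ∃ λ (D : Pred (PolishSpace.Carrier P) 0ℓ) → Comeagre (topologyOf P) D ×
        ContinuousOn (topologyOf P) (topologyOf Q) D f
    baireMeasurable⇒continuousOn P Q {f} measurable = D , D-comeagre , D-continuous
      where
      approx : ∀ j → BaireProperty P (f ⊢ Basic (topologyOf Q) j)
      approx j = measurable (Basic (topologyOf Q) j) (Metric.basic-open Q j)
      V : Index (topologyOf Q) → Pred (PolishSpace.Carrier P) 0ℓ
      V j = proj₁ (approx j)
      D : Pred (PolishSpace.Carrier P) 0ℓ
      D x = ∀ j → ¬ (((f ⊢ Basic (topologyOf Q) j) ∖ V j) ∪ (V j ∖ (f ⊢ Basic (topologyOf Q) j))) x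
      D-comeagre : Comeagre (topologyOf P) D
      D-comeagre = comeagre-⋂ (topologyOf P) (countable (topologyOf Q)) λ j →
        meagre-⊆ (topologyOf P) byContradiction (Metric.meager⇒meagre P em (proj₂ (proj₂ (approx j))))
      D-continuous : ContinuousOn (topologyOf P) (topologyOf Q) D f
      D-continuous {x} {j} x∈D fx∈j = nbhd-⊆ (topologyOf P)
        (λ y∈V y∈D → byContradiction λ fy∉j → y∈D j (inj₂ (y∈V , fy∉j)))
        (Metric.open⇒nbhd P (proj₁ (proj₂ (approx j)))
          (byContradiction λ x∉V → x∈D j (inj₁ (fx∈j , x∉V))))

  bounded⇒largest : ∀ {p} {P : Pred ℕ p} m → P 0 → (∀ k → P k → k ℕ.≤ m) → ∃ (Largest ℕ._≤_ P)
  bounded⇒largest zero P0 bound = 0 , P0 , bound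
  bounded⇒largest {P = P} (suc m) P0 bound with em {P = P (suc m)}
  ... | yes Pm = suc m , Pm , bound
  ... | no ¬Pm = bounded⇒largest m P0 λ k Pk → case ℕ.m≤n⇒m<n∨m≡n (bound k Pk) of λ where
    (inj₁ k<1+m) → ℕ.s≤s⁻¹ k<1+m
    (inj₂ refl)  → contradiction Pk ¬Pm

  -- Cubes travel along the embedding, so a finite dimension of `D` bounds the cubes in `C`. If the
  -- dimension of `C` is infinite, such a bound would produce a largest cube, as the 0-cube always
  -- embeds.
  dimension-monotone : ∀ {G H} (X : PolishGSpace G) (Y : PolishGSpace H) {C D n} →
    Embeds (𝓑 X C) (𝓑 Y D) → DimensionAtLeast X C n → ¬ ∃ λ k → HasDimension Y D k × k <∞ n
  dimension-monotone {G} X Y {C} {D} (φ , φ-mono) (k , dim , n≤k) (k′ , dim′ , k′<n) =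
    clash k dim n≤k k′ dim′ k′<n
    where
    transfer : ∀ {m} → Embeds (Cube m) (𝓑 X C) → Embeds (Cube m) (𝓑 Y D)
    transfer (ψ , ψ-mono) = φ ∘ ψ , Compose.isOrderMonomorphism ψ-mono φ-mono
    -- HasDimension X C ⊤⁺ would also hold if no cube at all embedded.
    cube₀ : Satisfiable C → Embeds (Cube 0) (𝓑 X C)
    cube₀ (x , x∈C) = (λ _ → x , x∈C) , record
      { isOrderHomomorphism = record
        { cong = λ _ → IsEquivalence.refl (OrbitEq-isEquivalence G X)
        ; mono = λ _ → rightEmbeds-refl G X x
        }
      ; injective = λ { {Vec.[]} {Vec.[]} _ → refl }
      ; cancel    = λ { {Vec.[]} {Vec.[]} _ () }
      }
    clash : ∀ {n} k → HasDimension X C k → n ≤∞ k → ∀ k′ → HasDimension Y D k′ → k′ <∞ n → ⊥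
    clash [ k ] (_ , cube , _) [ n≤k ] [ m ] (_ , _ , bound) [ m<n ] =
      ℕ.<-irrefl refl (ℕ.<-≤-trans m<n (ℕ.≤-trans n≤k (bound k (transfer cube))))
    clash ⊤⁺ (nonempty , ¬largest) _ [ m ] (_ , _ , bound) _ =
      ¬largest (bounded⇒largest m (cube₀ nonempty) λ k cube → bound k (transfer cube))

  module _ {G H : PolishGroup} (X : PolishGSpace G) (Y : PolishGSpace H) where
    private
      module X = PolishGSpace X
      module Y = PolishGSpace Y
      module XE = IsEquivalence (OrbitEq-isEquivalence G X)
      module YE = IsEquivalence (OrbitEq-isEquivalence H Y)

    module _ (f : X.Carrier → Y.Carrier) (measurable : BaireMeasurable X.space Y.space f)
             (preserving : CategoryPreserving X.space Y.space f)
             (reduces : ∀ x x′ → X.OrbitEq x x′ ⇔ Y.OrbitEq (f x) (f x′)) where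
      private
        D = baireMeasurable⇒continuousOn X.space Y.space measurable

        module R = GenericReduction em (topologicalGroup G) (topologicalGroup H) (action G X) (action H Y)
          (proj₁ (PolishSpace.separable X.space) 0) f (proj₁ D) (proj₁ (proj₂ D)) (proj₂ (proj₂ D))
          (λ {A} meagre → Metric.meager⇒meagre X.space em
            (preserving A (Metric.meagre⇒meager Y.space meagre)))
          (λ {x} {x′} → Equivalence.to (reduces x x′)) (λ {x} {x′} → Equivalence.from (reduces x x′))

        hom : ∀ {x x′} → X.OrbitEq x x′ → Y.OrbitEq (f x) (f x′)
        hom = Equivalence.to (reduces _ _)

        reflects : ∀ {x x′} → Y.OrbitEq (f x) (f x′) → X.OrbitEq x x′
        reflects = Equivalence.from (reduces _ _)

        preserved : ∀ {x x′} → x ∈ R.C → x′ ∈ R.C → X.RightEmbeds x x′ → Y.RightEmbeds (f x) (f x′)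
        preserved x∈ x′∈ embeds = rightEmbeds⇐ H Y (R.rightEmbeds-preserved x∈ x′∈ (rightEmbeds⇒ G X embeds))

        reflected : ∀ {x x′} → x ∈ R.C → x′ ∈ R.C → Y.RightEmbeds (f x) (f x′) → X.RightEmbeds x x′
        reflected x∈ x′∈ embeds =
          let z , z′ , z∼x , z′∼x′ , zz′ = R.rightEmbeds-reflected x∈ x′∈ (rightEmbeds⇒ H Y embeds)
          in rightEmbeds-resp G X z∼x z′∼x′ (rightEmbeds⇐ G X zz′)

      -- `R.C` need not be invariant and lives in a higher universe, whereas dimension is defined
      -- for sets in the lowest one.
      Saturated : Pred X.Carrier 0ℓ
      Saturated x = Small (∃ λ x₁ → x₁ ∈ R.C × X.OrbitEq x₁ x)

      saturate : ∀ {x₁ x} → x₁ ∈ R.C → X.OrbitEq x₁ x → x ∈ Saturated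
      saturate {x₁} {x} x₁∈C x₁∼x = small {P = ∃ λ x₁ → x₁ ∈ R.C × X.OrbitEq x₁ x} (x₁ , x₁∈C , x₁∼x)

      desaturate : ∀ {x} → x ∈ Saturated → ∃ λ x₁ → x₁ ∈ R.C × X.OrbitEq x₁ x
      desaturate {x} = large {P = ∃ λ x₁ → x₁ ∈ R.C × X.OrbitEq x₁ x}

      saturated-invariant : X.Invariant Saturated
      saturated-invariant g {x} sat =
        let x₁ , x₁∈C , x₁∼x = desaturate sat
        in saturate x₁∈C (XE.trans {x₁} {x} {g X.· x} x₁∼x (g , refl))

      saturated-comeager : Comeager X.space Saturated
      saturated-comeager = Metric.meagre⇒meager X.space (meagre-⊆ (topologyOf X.space)
        (λ {x} x∉ x∈C → x∉ (small (x , x∈C , XE.refl))) R.C-comeagre)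

      saturated-embeds : Embeds (𝓑 X Saturated) (𝓑 Y U)
      saturated-embeds = (λ (x , _) → f x , tt) , record
        { isOrderHomomorphism = record
          { cong = hom
          ; mono = λ { {_ , sat} {_ , sat′} embeds →
              let x₁ , x₁∈C , x₁∼x = large sat
                  x₂ , x₂∈C , x₂∼x = large sat′
              in rightEmbeds-resp H Y (hom x₁∼x) (hom x₂∼x)
                   (preserved x₁∈C x₂∈C (rightEmbeds-resp G X (XE.sym x₁∼x) (XE.sym x₂∼x) embeds)) }
          }
        ; injective = reflects
        ; cancel = λ { {_ , sat} {_ , sat′} embeds →
              let x₁ , x₁∈C , x₁∼x = large sat
                  x₂ , x₂∈C , x₂∼x = large sat′
              in rightEmbeds-resp G X x₁∼x x₂∼x
                   (reflected x₁∈C x₂∈C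
                     (rightEmbeds-resp H Y (YE.sym (hom x₁∼x)) (YE.sym (hom x₂∼x)) embeds)) }
        }

      image-invariant : Y.Invariant R.Image
      image-invariant = R.image-invariant

      image-nonmeager : ¬ Meager Y.space R.Image
      image-nonmeager meager = R.image-nonmeagre (Metric.meager⇒meagre Y.space em meager)

      image-baire : BaireProperty Y.space R.Image
      image-baire = let V , V-open , meagre = R.image-baire
                    in V , Metric.nbhd⇒open Y.space V-open , Metric.meagre⇒meager Y.space meagre

      -- Each vertex carries its own witness `x` in `R.C`. Different witnesses for one orbit of Y
      -- lie in one orbit of X because `f` reflects orbits, so the map is well defined on orbits.
      image-embeds : Embeds (𝓑 Y R.Image) (𝓑 X U)
      image-embeds = (λ (y , y∈) → proj₁ (R.image-C y∈) , tt) , record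
        { isOrderHomomorphism = record
          { cong = λ { {_ , y∈} {_ , y′∈} y∼y′ →
              let x , _ , fx∼y = R.image-C y∈
                  x′ , _ , fx′∼y′ = R.image-C y′∈
              in reflects (YE.trans fx∼y (YE.trans y∼y′ (YE.sym fx′∼y′))) }
          ; mono = λ { {_ , y∈} {_ , y′∈} embeds →
              let x , x∈C , fx∼y = R.image-C y∈
                  x′ , x′∈C , fx′∼y′ = R.image-C y′∈
              in reflected x∈C x′∈C (rightEmbeds-resp H Y (YE.sym fx∼y) (YE.sym fx′∼y′) embeds) }
          }
        ; injective = λ { {_ , y∈} {_ , y′∈} x∼x′ →
              let x , _ , fx∼y = R.image-C y∈
                  x′ , _ , fx′∼y′ = R.image-C y′∈
              in YE.trans (YE.sym fx∼y) (YE.trans (hom x∼x′) fx′∼y′) }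
        ; cancel = λ { {_ , y∈} {_ , y′∈} embeds →
              let x , x∈C , fx∼y = R.image-C y∈
                  x′ , x′∈C , fx′∼y′ = R.image-C y′∈
              in rightEmbeds-resp H Y fx∼y fx′∼y′ (preserved x∈C x′∈C embeds) }
        }

      generic-obstruction : ∀ {n} → GenericallyDimensional X n → ¬ DimensionLessThan Y n
      generic-obstruction (generic , _) = dimension-monotone X Y saturated-embeds
        (generic Saturated saturated-invariant saturated-comeager)

      local-obstruction : ∀ {n} → LocallyGenericallyDimensional Y n → ¬ DimensionLessThan X n
      local-obstruction (generic , _) = dimension-monotone Y X image-embeds
        (generic R.Image image-invariant image-nonmeager image-baire)

theorem7 : (∀ {ℓ} → ExcludedMiddle ℓ) →
    (G H : PolishGroup) (X : PolishGSpace G) (Y : PolishGSpace H) (n : ℕ∞) →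
    let module X = PolishGSpace X
        module Y = PolishGSpace Y
    in (GenericallyDimensional X n → DimensionLessThan Y n →
          ¬ *-Reduces X.space Y.space X.OrbitEq Y.OrbitEq)
     × (DimensionLessThan X n → LocallyGenericallyDimensional Y n →
          ¬ *-Reduces X.space Y.space X.OrbitEq Y.OrbitEq)
theorem7 em G H X Y n =
    (λ X-generic Y-small (f , measurable , preserving , reduces) →
      generic-obstruction em X Y f measurable preserving reduces X-generic Y-small)
  , (λ X-small Y-generic (f , measurable , preserving , reduces) →
      local-obstruction em X Y f measurable preserving reduces Y-generic X-small)
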